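{- For every integer $m\ge1$: $D_{ -m}(C(t);n)=0$ for $1\le n\le m$, and for $n\ge m+1$ $$D_{ -m}(C(t);n)=(-1)^{\binom{m+1}{2}}\,t^{\,n-m-1}\,D_{m+1}(C(t);n-m-1)$$ as an identity of polynomials in $t$.
   Context: The Narayana polynomials are $C_0(t)=1$ and $C_n(t)=\sum_{k=0}^{n-1}\binom{n-1}{k}\binom{n}{k}\frac{1}{k+1}t^k$ for $n\ge1$; they are extended by $C_n(t)=0$ for $n<0$. Their generating function $\sum_{n\ge0}C_n(t)x^n$ equals $\frac{1+x(t-1)-\sqrt{1-2x(t+1)+x^2(t-1)^2}}{2tx}$. For $m\in\mathbb Z$ and $n\ge0$, $D_m(C(t);n)=\det(C_{i+j+m}(t))_{i,j=0}^{n-1}$, the $0\times0$ determinant being $1$. -}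

module Defs where

open import Algebra.Bundles using (RawRing)
open import Data.Fin.Base using (Fin; zero; suc; toℕ)
open import Data.Integer.Base as ℤ using (ℤ; +_; -[1+_])
open import Data.List.Base using (List; []; _∷_; map; applyUpTo)
open import Data.Nat.Base as ℕ using (ℕ; zero; suc)
open import Data.Nat.Combinatorics using (_C_)
open import Data.Rational.Base as ℚ using (ℚ; 0ℚ; 1ℚ)
open import Data.Vec.Functional using (Vector; removeAt)
open import Level using (0ℓ)
open import Relation.Binary.PropositionalEquality using (_≡_)

import Algebra.Definitions.RawSemiring as RawSemiringDefs

-- Laplace expansion along the first row.
module Determinant {c ℓ} (R : RawRing c ℓ) where
  open RawRing R
  open RawSemiringDefs rawSemiring using (_^_; sum)

  Matrix : ℕ → Set c
  Matrix n = Vector (Vector Carrier n) n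

  minor : ∀ {n} → Matrix (suc n) → Fin (suc n) → Matrix n
  minor M j i = removeAt (M (suc i)) j

  det : ∀ n → Matrix n → Carrier
  det zero    M = 1#
  det (suc n) M = sum λ j → (- 1#) ^ toℕ j * M zero j * det n (minor M j)

-- ℚ[t]: the list a₀ ∷ a₁ ∷ … ∷ [] stands for a₀ + a₁ t + …. Trailing zeros are
-- allowed, so equality of polynomials is _≈ₚ_ rather than _≡_.
Poly : Set
Poly = List ℚ

coeff : Poly → ℕ → ℚ
coeff []      _       = 0ℚ
coeff (a ∷ p) zero    = a
coeff (a ∷ p) (suc k) = coeff p k

infix  4 _≈ₚ_
infixl 6 _+ₚ_
infixl 7 _*ₚ_

_≈ₚ_ : Poly → Poly → Set
p ≈ₚ q = ∀ k → coeff p k ≡ coeff q k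

_+ₚ_ : Poly → Poly → Poly
[]      +ₚ q       = q
(a ∷ p) +ₚ []      = a ∷ p
(a ∷ p) +ₚ (b ∷ q) = (a ℚ.+ b) ∷ (p +ₚ q)

_*ₚ_ : Poly → Poly → Poly
[]      *ₚ q = []
(a ∷ p) *ₚ q = map (a ℚ.*_) q +ₚ (0ℚ ∷ (p *ₚ q))

polyRing : RawRing 0ℓ 0ℓ
polyRing = record
  { Carrier = Poly
  ; _≈_     = _≈ₚ_
  ; _+_     = _+ₚ_
  ; _*_     = _*ₚ_
  ; -_      = map (ℚ.-_)
  ; 0#      = []
  ; 1#      = 1ℚ ∷ []
  }

t : Poly
t = 0ℚ ∷ 1ℚ ∷ []

narayana : ℤ → Poly
narayana (+ zero)  = 1ℚ ∷ []
narayana (+ suc n) =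
  applyUpTo (λ k → (+ ((n C k) ℕ.* (suc n C k))) ℚ./ suc k) (suc n)
narayana -[1+ _ ]  = []

D : ℤ → ℕ → Poly
D m n = Determinant.det polyRing n λ i j → narayana (+ toℕ i ℤ.+ + toℕ j ℤ.+ m)

{-# OPTIONS --safe #-}

-- The series g = 1/C has coefficients g₀ = 1, g₁ = −1 and gₙ₊₂ = −t Cₙ₊₁. Applying the unitriangular Toeplitz
-- matrix of g to the columns of (C_{i+j−m}) turns its first m+1 rows into antidiagonal unit rows, and leaves the
-- matrix with entries Σ_r C_{a−r} t C_{m+1+b+r} as the complementary block. That block is a unitriangular Toeplitz
-- matrix of C times t (C_{a+b+m+1}), so its determinant is tⁿ⁻ᵐ⁻¹ D_{m+1}.
--
-- That g C = 1 is the quadratic equation of C, obtained from the closed form of the coefficients through their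
-- three-term recurrence: with θ = x d/dx, y = g − t x C and Q = 1 − 2(1+t)x + (1−t)²x² it says Q θy = ½ (θQ) y.
-- Then y² and Q solve the same first-order equation, hence y² = Q, and 4 g t x C = (g + t x C)² − y² = 4 t x.
module Submission where

open import Algebra.Bundles using (CommutativeRing; RawRing)
import Algebra.Definitions.RawSemiring as RawSemiringDefs
open import Algebra.Morphism.Structures using (IsRingMonomorphism)
open import Algebra.Solver.Ring.AlmostCommutativeRing using (fromCommutativeRing; _-Raw-AlmostCommutative⟶_)
open import Data.Fin.Base using (Fin; zero; suc; toℕ; punchIn; _↑ʳ_)
import Data.Fin.Properties as Fin
open import Data.Integer.Base as ℤ using (ℤ; +_; -[1+_]; +0; +[1+_])
import Data.Integer.Properties as ℤ
import Data.Integer.Solver as ℤSolver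
open import Data.List.Base using ([]; _∷_; map; applyUpTo)
open import Data.Maybe.Base using (Maybe; just; nothing)
open import Data.Nat.Base as ℕ using (ℕ; zero; suc; _≤_; _<_; _∸_; z≤n; s≤s)
open import Data.Nat.Combinatorics as ℕ using (_C_)
import Data.Nat.Induction as ℕ
import Data.Nat.Properties as ℕ
open import Data.Product.Base using (_×_; _,_)
open import Data.Rational.Base as ℚ using (ℚ; 0ℚ; 1ℚ)
import Data.Rational.Properties as ℚ
open import Data.Rational.Unnormalised.Base as ℚᵘ using (mkℚᵘ; *≡*)
import Data.Rational.Unnormalised.Properties as ℚᵘ
open import Data.Unit.Polymorphic.Base using (⊤; tt)
open import Data.Vec.Base using (Vec; []; _∷_; tabulate)
open import Data.Vec.Functional using (Vector; removeAt)
open import Defs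
open import Function.Base using (_∘_; id)
open import Level using (0ℓ; _⊔_)
open import Relation.Binary.PropositionalEquality as ≡ using (_≡_)
open import Relation.Nullary.Decidable using (yes; no)

-- In terms of generating functions, row i ≤ m of the matrix is x^(m-i) C, so g leaves a single
-- power of x. Row m+1+a is C with its first a+1 terms cut off, divided by x^(a+1). Since g C = 1,
-- its product with g beyond the constant term is minus the contribution of the cut-off terms, and
-- that contribution only meets coefficients of g from x² on. There g coincides with -t x C: this is
-- the origin of the factor t and of the index m+1.
--
-- The square root in the generating function is never extracted. Comparing y² with Q needs only a
-- first-order equation whose solutions are fixed by their constant term, and the argument cancels
-- nothing but positive integers and t. Hence the reciprocal is computed over any commutative ring
-- with these two cancellation laws, the determinants over any commutative ring at all; lists of
-- rationals only instantiate the result.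

module IntegerSolver {c ℓ} (R : CommutativeRing c ℓ) where
  open CommutativeRing R
  open import Algebra.Properties.Ring ring
  open import Algebra.Properties.Semiring.Mult.TCOptimised semiring using (1+×; ×-homo-+; ×1-homo-*) renaming (_×_ to _·_)
  open import Relation.Binary.Reasoning.Setoid setoid

  -- Solver coefficients are integers because equality in an abstract carrier cannot be decided. The
  -- optimised multiple reduces `fromℤ (+ 1)` to `1#`, so `con ℤ.1ℤ` denotes a literal `1#`.
  fromℤ : ℤ → Carrier
  fromℤ (+ n)    = n · 1#
  fromℤ -[1+ n ] = - (suc n · 1#)

  cancel-shift : ∀ x y z → (x + y) - (x + z) ≈ y - z
  cancel-shift x y z = begin
    (x + y) - (x + z)       ≈⟨ +-cong (+-comm x y) (sym (-‿+-comm x z)) ⟩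
    (y + x) + (- x + - z)   ≈⟨ +-assoc y x _ ⟩
    y + (x + (- x + - z))   ≈⟨ +-congˡ (+-assoc x (- x) (- z)) ⟨
    y + ((x + - x) + - z)   ≈⟨ +-congˡ (+-congʳ (-‿inverseʳ x)) ⟩
    y + (0# + - z)          ≈⟨ +-congˡ (+-identityˡ (- z)) ⟩
    y - z                   ∎

  fromℤ-⊖ : ∀ m n → fromℤ (m ℤ.⊖ n) ≈ m · 1# - n · 1#
  fromℤ-⊖ m       zero    = sym (trans (+-congˡ -0#≈0#) (+-identityʳ _))
  fromℤ-⊖ zero    (suc n) = sym (+-identityˡ _)
  fromℤ-⊖ (suc m) (suc n) = begin
    fromℤ (suc m ℤ.⊖ suc n)          ≡⟨ ≡.cong fromℤ (ℤ.[1+m]⊖[1+n]≡m⊖n m n) ⟩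
    fromℤ (m ℤ.⊖ n)                  ≈⟨ fromℤ-⊖ m n ⟩
    m · 1# - n · 1#                  ≈⟨ cancel-shift 1# _ _ ⟨
    (1# + m · 1#) - (1# + n · 1#)    ≈⟨ +-cong (1+× m 1#) (-‿cong (1+× n 1#)) ⟨
    suc m · 1# - suc n · 1#          ∎

  fromℤ-+ : ∀ i j → fromℤ (i ℤ.+ j) ≈ fromℤ i + fromℤ j
  fromℤ-+ (+ m)    (+ n)    = ×-homo-+ 1# m n
  fromℤ-+ (+ m)    -[1+ n ] = fromℤ-⊖ m (suc n)
  fromℤ-+ -[1+ m ] (+ n)    = trans (fromℤ-⊖ n (suc m)) (+-comm _ _)
  fromℤ-+ -[1+ m ] -[1+ n ] = begin
    - (suc (suc (m ℕ.+ n)) · 1#)            ≡⟨ ≡.cong (λ k → - (suc k · 1#)) (≡.sym (ℕ.+-suc m n)) ⟩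
    - ((suc m ℕ.+ suc n) · 1#)              ≈⟨ -‿cong (×-homo-+ 1# (suc m) (suc n)) ⟩
    - (suc m · 1# + suc n · 1#)             ≈⟨ -‿+-comm _ _ ⟨
    - (suc m · 1#) - suc n · 1#             ∎

  fromℤ-neg : ∀ i → fromℤ (ℤ.- i) ≈ - fromℤ i
  fromℤ-neg +0       = sym -0#≈0#
  fromℤ-neg +[1+ n ] = refl
  fromℤ-neg -[1+ n ] = sym (-‿involutive _)

  fromℤ-⁺* : ∀ m j → fromℤ (+ m ℤ.* j) ≈ m · 1# * fromℤ j
  fromℤ-⁺* m (+ n) = begin
    fromℤ (+ m ℤ.* + n)              ≡⟨ ≡.cong fromℤ (≡.sym (ℤ.pos-* m n)) ⟩
    (m ℕ.* n) · 1#                   ≈⟨ ×1-homo-* m n ⟩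
    m · 1# * n · 1#                  ∎
  fromℤ-⁺* m -[1+ n ] = begin
    fromℤ (+ m ℤ.* ℤ.- +[1+ n ])     ≡⟨ ≡.cong fromℤ (≡.sym (ℤ.neg-distribʳ-* (+ m) +[1+ n ])) ⟩
    fromℤ (ℤ.- (+ m ℤ.* +[1+ n ]))   ≈⟨ fromℤ-neg (+ m ℤ.* +[1+ n ]) ⟩
    - fromℤ (+ m ℤ.* +[1+ n ])       ≈⟨ -‿cong (fromℤ-⁺* m +[1+ n ]) ⟩
    - (m · 1# * suc n · 1#)          ≈⟨ -‿distribʳ-* _ _ ⟩
    m · 1# * fromℤ -[1+ n ]          ∎

  fromℤ-* : ∀ i j → fromℤ (i ℤ.* j) ≈ fromℤ i * fromℤ j
  fromℤ-* (+ m)    j = fromℤ-⁺* m j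
  fromℤ-* -[1+ m ] j = begin
    fromℤ (ℤ.- +[1+ m ] ℤ.* j)       ≡⟨ ≡.cong fromℤ (≡.sym (ℤ.neg-distribˡ-* +[1+ m ] j)) ⟩
    fromℤ (ℤ.- (+[1+ m ] ℤ.* j))     ≈⟨ fromℤ-neg (+[1+ m ] ℤ.* j) ⟩
    - fromℤ (+[1+ m ] ℤ.* j)         ≈⟨ -‿cong (fromℤ-⁺* (suc m) j) ⟩
    - (suc m · 1# * fromℤ j)         ≈⟨ -‿distribˡ-* _ _ ⟩
    fromℤ -[1+ m ] * fromℤ j         ∎

  fromℤ-morphism : ℤ.+-*-rawRing -Raw-AlmostCommutative⟶ fromCommutativeRing R
  fromℤ-morphism = record
    { ⟦_⟧    = fromℤ
    ; +-homo = fromℤ-+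
    ; *-homo = fromℤ-*
    ; -‿homo = fromℤ-neg
    ; 0-homo = refl
    ; 1-homo = refl
    }

  weaklyDecide : ∀ i j → Maybe (fromℤ i ≈ fromℤ j)
  weaklyDecide i j with i ℤ.≟ j
  ... | yes i≡j = just (reflexive (≡.cong fromℤ i≡j))
  ... | no  _   = nothing

  open import Algebra.Solver.Ring ℤ.+-*-rawRing (fromCommutativeRing R) fromℤ-morphism weaklyDecide public
    using (Polynomial; solve; _:=_; con; _:+_; _:*_; _:-_; :-_)

-- Cauchy products of sequences and the ring of power series

module Convolution {c ℓ} (R : CommutativeRing c ℓ) where
  open CommutativeRing R
  open IntegerSolver R
  open import Relation.Binary.Reasoning.Setoid setoid

  infix 4 _≋_
  _≋_ : (ℕ → Carrier) → (ℕ → Carrier) → Set ℓ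
  u ≋ s = ∀ n → u n ≈ s n

  -- The recursion splits off `s 0`, which avoids subtracting indices. When `s` is a sequence of
  -- columns, one unfolding is one step of column elimination.
  conv : (ℕ → Carrier) → (ℕ → Carrier) → ℕ → Carrier
  conv u s zero    = u 0 * s 0
  conv u s (suc n) = u (suc n) * s 0 + conv u (s ∘ suc) n

  one : ℕ → Carrier
  one zero    = 1#
  one (suc _) = 0#

  conv-cong : ∀ {u u′ s s′} → u ≋ u′ → s ≋ s′ → conv u s ≋ conv u′ s′
  conv-cong p q zero    = *-cong (p 0) (q 0)
  conv-cong p q (suc n) = +-cong (*-cong (p (suc n)) (q 0)) (conv-cong p (q ∘ suc) n)

  conv-zeroˡ : ∀ u s n → (∀ i → i ≤ n → u i ≈ 0#) → conv u s n ≈ 0#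
  conv-zeroˡ u s zero    z = trans (*-congʳ (z 0 z≤n)) (zeroˡ _)
  conv-zeroˡ u s (suc n) z = begin
    u (suc n) * s 0 + conv u (s ∘ suc) n ≈⟨ +-cong (trans (*-congʳ (z (suc n) ℕ.≤-refl)) (zeroˡ _))
                                                   (conv-zeroˡ u (s ∘ suc) n λ i i≤n → z i (ℕ.m≤n⇒m≤1+n i≤n)) ⟩
    0# + 0#                              ≈⟨ +-identityˡ 0# ⟩
    0#                                   ∎

  conv-zeroʳ : ∀ u n → conv u (λ _ → 0#) n ≈ 0#
  conv-zeroʳ u zero    = zeroʳ _
  conv-zeroʳ u (suc n) = trans (+-cong (zeroʳ _) (conv-zeroʳ u n)) (+-identityˡ 0#)

  conv-leading : ∀ u s n → (∀ i → i < n → u i ≈ 0#) → conv u s n ≈ u n * s 0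
  conv-leading u s zero    z = refl
  conv-leading u s (suc n) z =
    trans (+-congˡ (conv-zeroˡ u (s ∘ suc) n λ i i≤n → z i (s≤s i≤n))) (+-identityʳ _)

  conv-suc : ∀ u s n → conv u s (suc n) ≈ conv (u ∘ suc) s n + u 0 * s (suc n)
  conv-suc u s zero    = refl
  conv-suc u s (suc n) = trans (+-congˡ (conv-suc u (s ∘ suc) n)) (sym (+-assoc _ _ _))

  conv-comm : ∀ u s → conv u s ≋ conv s u
  conv-comm u s zero    = *-comm _ _
  conv-comm u s (suc n) = begin
    u (suc n) * s 0 + conv u (s ∘ suc) n  ≈⟨ +-cong (*-comm _ _) (conv-comm u (s ∘ suc) n) ⟩
    s 0 * u (suc n) + conv (s ∘ suc) u n  ≈⟨ +-comm _ _ ⟩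
    conv (s ∘ suc) u n + s 0 * u (suc n)  ≈⟨ conv-suc s u n ⟨
    conv s u (suc n)                      ∎

  conv-distribˡ : ∀ u s w n → conv u (λ k → s k + w k) n ≈ conv u s n + conv u w n
  conv-distribˡ u s w zero    = distribˡ _ _ _
  conv-distribˡ u s w (suc n) = trans (+-congˡ (conv-distribˡ u (s ∘ suc) (w ∘ suc) n))
    (solve 5 (λ a b c d e → a :* (b :+ c) :+ (d :+ e) := (a :* b :+ d) :+ (a :* c :+ e))
      refl (u (suc n)) (s 0) (w 0) _ _)

  conv-scaleʳ : ∀ u s c n → conv u (λ k → s k * c) n ≈ conv u s n * c
  conv-scaleʳ u s c zero    = sym (*-assoc _ _ _)
  conv-scaleʳ u s c (suc n) = trans (+-cong (sym (*-assoc _ _ _)) (conv-scaleʳ u (s ∘ suc) c n))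
    (sym (distribʳ _ _ _))

  conv-assoc : ∀ u s w → conv (conv u s) w ≋ conv u (conv s w)
  conv-assoc u s w zero    = *-assoc _ _ _
  conv-assoc u s w (suc n) = begin
    (u (suc n) * s 0 + conv u (s ∘ suc) n) * w 0 + conv (conv u s) (w ∘ suc) n
      ≈⟨ +-congˡ (conv-assoc u s (w ∘ suc) n) ⟩
    (u (suc n) * s 0 + conv u (s ∘ suc) n) * w 0 + conv u (conv s (w ∘ suc)) n
      ≈⟨ solve 5 (λ a b c d e → (a :* b :+ c) :* d :+ e := a :* (b :* d) :+ (c :* d :+ e)) refl
           (u (suc n)) (s 0) _ (w 0) _ ⟩
    u (suc n) * (s 0 * w 0) + (conv u (s ∘ suc) n * w 0 + conv u (conv s (w ∘ suc)) n)
      ≈⟨ +-congˡ (+-congʳ (conv-scaleʳ u (s ∘ suc) (w 0) n)) ⟨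
    u (suc n) * (s 0 * w 0) + (conv u (λ k → s (suc k) * w 0) n + conv u (conv s (w ∘ suc)) n)
      ≈⟨ +-congˡ (conv-distribˡ u (λ k → s (suc k) * w 0) (conv s (w ∘ suc)) n) ⟨
    conv u (conv s w) (suc n) ∎

  conv-identityʳ : ∀ u → conv u one ≋ u
  conv-identityʳ u zero    = *-identityʳ _
  conv-identityʳ u (suc n) =
    trans (+-cong (*-identityʳ _) (conv-zeroʳ u n)) (+-identityʳ _)

  -- The terms in which `s` has index at most `a` form the first summand, the later ones the second.
  conv-split : ∀ u s a j →
    conv u s (suc a ℕ.+ j) ≈ conv (λ r → u (suc j ℕ.+ r)) s a + conv u (λ l → s (suc a ℕ.+ l)) j
  conv-split u s zero    j = +-congʳ (*-congʳ (reflexive (≡.cong u (≡.sym (ℕ.+-identityʳ (suc j))))))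
  conv-split u s (suc a) j = begin
    u (suc (suc a ℕ.+ j)) * s 0 + conv u (s ∘ suc) (suc a ℕ.+ j)
      ≈⟨ +-cong (*-congʳ (reflexive (≡.cong (u ∘ suc) (ℕ.+-comm (suc a) j)))) (conv-split u (s ∘ suc) a j) ⟩
    u (suc j ℕ.+ suc a) * s 0 + (conv (λ r → u (suc j ℕ.+ r)) (s ∘ suc) a + conv u (λ l → s (suc (suc a ℕ.+ l))) j)
      ≈⟨ +-assoc _ _ _ ⟨
    conv (λ r → u (suc j ℕ.+ r)) s (suc a) + conv u (λ l → s (suc (suc a) ℕ.+ l)) j ∎

  powerSeries : CommutativeRing c ℓ
  powerSeries = record
    { Carrier = ℕ → Carrier
    ; _≈_ = _≋_
    ; _+_ = λ u s n → u n + s n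
    ; _*_ = conv
    ; -_  = λ u n → - u n
    ; 0#  = λ _ → 0#
    ; 1#  = one
    ; isCommutativeRing = record
      { isRing = record
        { +-isAbelianGroup = record
          { isGroup = record
            { isMonoid = record
              { isSemigroup = record
                { isMagma = record
                  { isEquivalence = record
                    { refl  = λ _ → refl
                    ; sym   = λ p n → sym (p n)
                    ; trans = λ p q n → trans (p n) (q n)
                    }
                  ; ∙-cong = λ p q n → +-cong (p n) (q n)
                  }
                ; assoc = λ u s w n → +-assoc (u n) (s n) (w n)
                }
              ; identity = (λ u n → +-identityˡ (u n)) , (λ u n → +-identityʳ (u n))
              }
            ; inverse = (λ u n → -‿inverseˡ (u n)) , (λ u n → -‿inverseʳ (u n))
            ; ⁻¹-cong = λ p n → -‿cong (p n)
            }
          ; comm = λ u s n → +-comm (u n) (s n)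
          }
        ; *-cong = conv-cong
        ; *-assoc = conv-assoc
        ; *-identity = (λ u n → trans (conv-comm one u n) (conv-identityʳ u n)) , conv-identityʳ
        ; distrib = conv-distribˡ , λ u s w n → trans (conv-comm _ u n)
            (trans (conv-distribˡ u s w n) (+-cong (conv-comm u s n) (conv-comm u w n)))
        }
      ; *-comm = conv-comm
      }
    }

  open import Algebra.Properties.Semiring.Mult semiring using () renaming (_×_ to _·_)

  -- Built on the unoptimised multiple, so that `ι (suc n)` is `1# + ι n` by definition; solver
  -- calls mirror this by nested sums ending in zero.
  ι : ℕ → Carrier
  ι n = n · 1#

  θ : (ℕ → Carrier) → (ℕ → Carrier)
  θ u n = ι n * u n

  θ-leibniz : ∀ u s n → θ (conv u s) n ≈ conv (θ u) s n + conv u (θ s) n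
  θ-leibniz u s zero    = solve 2 (λ a b → con ℤ.0ℤ :* (a :* b) := con ℤ.0ℤ :* a :* b :+ a :* (con ℤ.0ℤ :* b)) refl (u 0) (s 0)
  θ-leibniz u s (suc n) = begin
    (1# + ι n) * (u (suc n) * s 0 + conv u (s ∘ suc) n)
      ≈⟨ distribˡ _ _ _ ⟩
    (1# + ι n) * (u (suc n) * s 0) + (1# + ι n) * conv u (s ∘ suc) n
      ≈⟨ +-congˡ (trans (distribʳ _ _ _) (+-cong (*-identityˡ _) (θ-leibniz u (s ∘ suc) n))) ⟩
    (1# + ι n) * (u (suc n) * s 0) + (conv u (s ∘ suc) n + (conv (θ u) (s ∘ suc) n + conv u (θ (s ∘ suc)) n))
      ≈⟨ solve 6 (λ i a b x y z → i :* (a :* b) :+ (x :+ (y :+ z)) := (i :* a :* b :+ y) :+ (a :* (con ℤ.0ℤ :* b) :+ (x :+ z)))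
           refl (ι (suc n)) (u (suc n)) (s 0) _ _ _ ⟩
    conv (θ u) s (suc n) + (u (suc n) * (0# * s 0) + (conv u (s ∘ suc) n + conv u (θ (s ∘ suc)) n))
      -- The shift of `θ s` is `θ` of the shift plus one copy of the shift; the spare convolution
      -- supplies that copy.
      ≈⟨ +-congˡ (+-congˡ (conv-distribˡ u (s ∘ suc) (θ (s ∘ suc)) n)) ⟨
    conv (θ u) s (suc n) + (u (suc n) * (0# * s 0) + conv u (λ k → s (suc k) + θ (s ∘ suc) k) n)
      ≈⟨ +-congˡ (+-congˡ (conv-cong (λ _ → refl) (λ k → trans (distribʳ _ _ _) (+-congʳ (*-identityˡ _))) n)) ⟨
    conv (θ u) s (suc n) + conv u (θ s) (suc n) ∎

-- Determinants: Laplace expansion and transposition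

module DeterminantProperties {c ℓ} (R : CommutativeRing c ℓ) where
  open CommutativeRing R hiding (zero)
  open Determinant rawRing public
  open RawSemiringDefs (RawRing.rawSemiring rawRing) using (_^_; sum)
  open IntegerSolver R
  open Convolution R using (conv)
  open import Algebra.Properties.Ring ring using (-1*x≈-x; -0#≈0#)
  open import Algebra.Properties.Semiring.Sum semiring using (sum-cong-≋; *-distribˡ-sum; ∑-comm)
  open import Algebra.Properties.Semiring.Exp semiring using (^-homo-*)
  open import Relation.Binary.Reasoning.Setoid setoid

  det-cong : ∀ n {M N : Matrix n} → (∀ i j → M i j ≈ N i j) → det n M ≈ det n N
  det-cong zero    p = refl
  det-cong (suc n) p = sum-cong-≋ λ j →
    *-cong (*-congˡ {x = (- 1#) ^ toℕ j} (p zero j)) (det-cong n λ i k → p (suc i) (punchIn j k))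

  -- By induction each first-row minor is expanded along its own first column. Exchanging the two
  -- sums regroups the same double minors `X i j` by row.
  det-firstColumn : ∀ n (M : Matrix (suc n)) → det (suc n) M ≈
    sum λ i → (- 1#) ^ toℕ i * M i zero * det n (λ a b → M (punchIn i a) (suc b))
  det-firstColumn zero    M = refl
  det-firstColumn (suc n) M = +-congˡ (begin
    sum (λ j → (- 1#) ^ suc (toℕ j) * M zero (suc j) * det (suc n) (minor M (suc j)))
      ≈⟨ sum-cong-≋ (λ j → *-congˡ {x = (- 1#) ^ suc (toℕ j) * M zero (suc j)} (det-firstColumn n (minor M (suc j)))) ⟩
    sum (λ j → (- 1#) ^ suc (toℕ j) * M zero (suc j) * sum (λ i → (- 1#) ^ toℕ i * M (suc i) zero * X i j))
      ≈⟨ sum-cong-≋ (λ j → *-distribˡ-sum ((- 1#) ^ suc (toℕ j) * M zero (suc j)) (λ i → (- 1#) ^ toℕ i * M (suc i) zero * X i j)) ⟩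
    sum (λ j → sum (λ i → (- 1#) ^ suc (toℕ j) * M zero (suc j) * ((- 1#) ^ toℕ i * M (suc i) zero * X i j)))
      ≈⟨ ∑-comm (λ j i → (- 1#) ^ suc (toℕ j) * M zero (suc j) * ((- 1#) ^ toℕ i * M (suc i) zero * X i j)) ⟩
    sum (λ i → sum (λ j → (- 1#) ^ suc (toℕ j) * M zero (suc j) * ((- 1#) ^ toℕ i * M (suc i) zero * X i j)))
      ≈⟨ sum-cong-≋ (λ i → sum-cong-≋ (λ j →
           solve 6 (λ e p q a b x → e :* p :* a :* (q :* b :* x) := e :* q :* b :* (p :* a :* x)) refl
             (- 1#) ((- 1#) ^ toℕ j) ((- 1#) ^ toℕ i) (M zero (suc j)) (M (suc i) zero) (X i j))) ⟩
    sum (λ i → sum (λ j → (- 1#) ^ suc (toℕ i) * M (suc i) zero * ((- 1#) ^ toℕ j * M zero (suc j) * X i j)))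
      ≈⟨ sum-cong-≋ (λ i → *-distribˡ-sum ((- 1#) ^ suc (toℕ i) * M (suc i) zero) (λ j → (- 1#) ^ toℕ j * M zero (suc j) * X i j)) ⟨
    sum (λ i → (- 1#) ^ suc (toℕ i) * M (suc i) zero * det (suc n) (λ a b → M (punchIn (suc i) a) (suc b))) ∎)
    where
    X : Fin (suc n) → Fin (suc n) → Carrier
    X i j = det n (λ a b → M (suc (punchIn i a)) (suc (punchIn j b)))

  det-transpose : ∀ n (M : Matrix n) → det n (λ i j → M j i) ≈ det n M
  det-transpose zero    M = refl
  det-transpose (suc n) M = trans
    (sum-cong-≋ λ j → *-congˡ {x = (- 1#) ^ toℕ j * M j zero} (det-transpose n λ a b → M (punchIn j a) (suc b)))
    (sym (det-firstColumn n M))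

  det-scale : ∀ n x (M : Matrix n) → det n (λ i j → x * M i j) ≈ x ^ n * det n M
  det-scale zero    x M = sym (*-identityˡ 1#)
  det-scale (suc n) x M = trans
    (sum-cong-≋ λ j → trans (*-congˡ (det-scale n x (minor M j)))
      (solve 5 (λ e x m y d → e :* (x :* m) :* (y :* d) := x :* y :* (e :* m :* d)) refl
        ((- 1#) ^ toℕ j) x (M zero j) (x ^ n) (det n (minor M j))))
    (sym (*-distribˡ-sum (x ^ suc n) (λ j → (- 1#) ^ toℕ j * M zero j * det n (minor M j))))

  det-zeroRow : ∀ n (M : Matrix (suc n)) → (∀ j → M zero j ≈ 0#) → det (suc n) M ≈ 0#
  det-zeroRow n M z = trans
    (sum-cong-≋ λ j → trans (*-congʳ (trans (*-congˡ {x = (- 1#) ^ toℕ j} (z j)) (zeroʳ _))) (trans (zeroˡ (det n (minor M j))) (sym (zeroˡ 0#))))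
    (trans (sym (*-distribˡ-sum 0# (λ (_ : Fin (suc n)) → 0#))) (zeroˡ _))

  -- Alternating forms, and column operations on determinants

  V : Set c
  V = ℕ → Carrier

  Form : ℕ → Set c
  Form n = Vec V n → Carrier

  VanishesOnRepeat : ∀ n → Form (suc n) → Set (c ⊔ ℓ)
  VanishesOnRepeat zero    f = ⊤ {c ⊔ ℓ}
  VanishesOnRepeat (suc n) f = ∀ v vs → f (v ∷ v ∷ vs) ≈ 0#

  Congruent : ∀ {n} → Form (suc n) → Set _
  Congruent f = ∀ {v w} vs → (∀ i → v i ≈ w i) → f (v ∷ vs) ≈ f (w ∷ vs)

  Linear : ∀ {n} → Form (suc n) → Set _
  Linear f = ∀ x v w vs → f ((λ i → x * v i + w i) ∷ vs) ≈ x * f (v ∷ vs) + f (w ∷ vs)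

  -- Conditions are put on the leading arguments only; demanding that every contraction `f ∘ (v ∷_)`
  -- be alternating again carries them to all positions without indexing the arguments.
  Alternating : ∀ n → Form n → Set (c ⊔ ℓ)
  Alternating zero    f = ⊤ {c ⊔ ℓ}
  Alternating (suc n) f =
    (∀ v → Alternating n (f ∘ (v ∷_))) × Congruent f × Linear f × VanishesOnRepeat n f

  -- This combination is the shape of a contracted wedge product, a scalar times `g` minus a wedge
  -- with a contraction of `g`.
  alternating-combine : ∀ n x f g → Alternating n f → Alternating n g →
    Alternating n (λ vs → x * f vs - g vs)
  alternating-combine zero    x f g _ _ = tt
  alternating-combine (suc n) x f g (F , cf , lf , rf) (G , cg , lg , rg) =
      (λ v → alternating-combine n x (f ∘ (v ∷_)) (g ∘ (v ∷_)) (F v) (G v))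
    , (λ vs v≈w → +-cong (*-congˡ (cf vs v≈w)) (-‿cong (cg vs v≈w)))
    , (λ y v w vs → trans (+-cong (*-congˡ (lf y v w vs)) (-‿cong (lg y v w vs)))
        (solve 6 (λ x y a b c d → x :* (y :* a :+ b) :- (y :* c :+ d) := y :* (x :* a :- c) :+ (x :* b :- d)) refl
          x y (f (v ∷ vs)) (f (w ∷ vs)) (g (v ∷ vs)) (g (w ∷ vs))))
    , repeat n f g rf rg
    where
    repeat : ∀ n f g → VanishesOnRepeat n f → VanishesOnRepeat n g → VanishesOnRepeat n (λ vs → x * f vs - g vs)
    repeat zero    f g rf rg = tt
    repeat (suc n) f g rf rg v vs = trans (+-cong (trans (*-congˡ (rf v vs)) (zeroʳ x)) (-‿cong (rg v vs))) (-‿inverseʳ 0#)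

  -- The wedge product with a linear form: contracting with v anticommutes with h ∧_.
  infixr 7 _∧_
  _∧_ : ∀ {n} → (V → Carrier) → Form n → Form (suc n)
  _∧_ {zero}  h g (v ∷ []) = h v * g []
  _∧_ {suc n} h g (v ∷ vs) = h v * g vs - (h ∧ (g ∘ (v ∷_))) vs

  ∧-cong : ∀ {n} h {f g : Form n} → (∀ vs → f vs ≈ g vs) → ∀ vs → (h ∧ f) vs ≈ (h ∧ g) vs
  ∧-cong {zero}  h p (v ∷ []) = *-congˡ (p [])
  ∧-cong {suc n} h p (v ∷ vs) = +-cong (*-congˡ (p vs)) (-‿cong (∧-cong h (p ∘ (v ∷_)) vs))

  ∧-zero : ∀ {n} h {f : Form n} → (∀ vs → f vs ≈ 0#) → ∀ vs → (h ∧ f) vs ≈ 0#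
  ∧-zero {zero}  h p (v ∷ []) = trans (*-congˡ (p [])) (zeroʳ _)
  ∧-zero {suc n} h p (v ∷ vs) = trans
    (+-cong (trans (*-congˡ (p vs)) (zeroʳ _)) (-‿cong (∧-zero h (p ∘ (v ∷_)) vs))) (-‿inverseʳ 0#)

  ∧-linear : ∀ {n} h x (f g : Form n) vs → (h ∧ (λ ws → x * f ws + g ws)) vs ≈ x * (h ∧ f) vs + (h ∧ g) vs
  ∧-linear {zero}  h x f g (v ∷ []) = solve 4 (λ h x f g → h :* (x :* f :+ g) := x :* (h :* f) :+ h :* g) refl
    (h v) x (f []) (g [])
  ∧-linear {suc n} h x f g (v ∷ vs) = trans (+-congˡ (-‿cong (∧-linear h x (f ∘ (v ∷_)) (g ∘ (v ∷_)) vs)))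
    (solve 6 (λ h x a b c d → h :* (x :* a :+ b) :- (x :* c :+ d) := x :* (h :* a :- c) :+ (h :* b :- d)) refl
      (h v) x (f vs) (g vs) _ _)

  ∧-alternating : ∀ {n} k (g : Form n) → Alternating n g → Alternating (suc n) ((λ v → v k) ∧ g)
  ∧-alternating {zero}  k g _ =
      (λ _ → tt)
    , (λ { [] v≈w → *-congʳ (v≈w k) })
    , (λ { x v w [] → solve 4 (λ x v w g → (x :* v :+ w) :* g := x :* (v :* g) :+ w :* g) refl x (v k) (w k) (g []) })
    , tt
  ∧-alternating {suc n} k g (G , cg , lg , rg) =
      (λ v → alternating-combine (suc n) (v k) g _ (G , cg , lg , rg) (∧-alternating k (g ∘ (v ∷_)) (G v)))
    , (λ vs v≈w → +-cong (*-congʳ (v≈w k)) (-‿cong (∧-cong (λ v → v k) (λ ws → cg ws v≈w) vs)))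
    , (λ x v w vs → trans
        (+-congˡ (-‿cong (trans (∧-cong (λ v → v k) (lg x v w) vs) (∧-linear (λ v → v k) x (g ∘ (v ∷_)) (g ∘ (w ∷_)) vs))))
        (solve 6 (λ x v w g a b → (x :* v :+ w) :* g :- (x :* a :+ b) := x :* (v :* g :- a) :+ (w :* g :- b)) refl
          x (v k) (w k) (g vs) _ _))
    , repeat n g rg
    where
    repeat : ∀ n (g : Form (suc n)) → VanishesOnRepeat n g → VanishesOnRepeat (suc n) ((λ v → v k) ∧ g)
    repeat zero    g rg v []       = -‿inverseʳ _
    -- Contracting twice with `v` produces `v k * g (v ∷ vs)` with both signs, plus a wedge with `g`
    -- contracted twice by `v`, which `rg` kills.
    repeat (suc n) g rg v vs = trans
      (+-congˡ (-‿cong (trans (+-congˡ (trans (-‿cong (∧-zero (λ v → v k) (rg v) vs)) -0#≈0#)) (+-identityʳ _))))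
      (-‿inverseʳ _)

  -- Vanishing whenever `v` occurs among the arguments, unfolded position by position.
  Annihilates : V → ∀ n → Form n → Set (c ⊔ ℓ)
  Annihilates v zero    f = ⊤ {c ⊔ ℓ}
  Annihilates v (suc n) f = (∀ vs → f (v ∷ vs) ≈ 0#) × (∀ w → Annihilates v n (f ∘ (w ∷_)))

  annihilates-neg : ∀ v n f g → (∀ vs → f vs ≈ - g vs) → Annihilates v n g → Annihilates v n f
  annihilates-neg v zero    f g p _ = tt
  annihilates-neg v (suc n) f g p (z , r) =
      (λ vs → trans (p (v ∷ vs)) (trans (-‿cong (z vs)) -0#≈0#))
    , (λ w → annihilates-neg v n (f ∘ (w ∷_)) (g ∘ (w ∷_)) (p ∘ (w ∷_)) (r w))

  -- Polarisation: the vanishing value at (s, s) is expanded for s = v + w. The coefficient `1#` in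
  -- `s` only gives the sum the shape of `Linear`.
  alternating-swap : ∀ n f → Alternating (suc (suc n)) f → ∀ v w vs → f (v ∷ w ∷ vs) ≈ - f (w ∷ v ∷ vs)
  alternating-swap n f (F , cf , lf , rf) v w vs = begin
    f (v ∷ w ∷ vs)
      ≈⟨ solve 2 (λ a b → a := (con ℤ.1ℤ :* (con ℤ.1ℤ :* con ℤ.0ℤ :+ a) :+ (con ℤ.1ℤ :* b :+ con ℤ.0ℤ)) :- b) refl (f (v ∷ w ∷ vs)) (f (w ∷ v ∷ vs)) ⟩
    (1# * (1# * 0# + f (v ∷ w ∷ vs)) + (1# * f (w ∷ v ∷ vs) + 0#)) - f (w ∷ v ∷ vs)
      ≈⟨ +-congʳ (+-cong (*-congˡ (+-congʳ (*-congˡ (rf v vs)))) (+-congˡ (rf w vs))) ⟨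
    (1# * (1# * f (v ∷ v ∷ vs) + f (v ∷ w ∷ vs)) + (1# * f (w ∷ v ∷ vs) + f (w ∷ w ∷ vs))) - f (w ∷ v ∷ vs)
      ≈⟨ +-congʳ (+-cong (*-congˡ (second v)) (second w)) ⟨
    (1# * f (v ∷ s ∷ vs) + f (w ∷ s ∷ vs)) - f (w ∷ v ∷ vs)
      ≈⟨ +-congʳ (lf 1# v w (s ∷ vs)) ⟨
    f (s ∷ s ∷ vs) - f (w ∷ v ∷ vs)
      ≈⟨ +-congʳ (rf s vs) ⟩
    0# - f (w ∷ v ∷ vs)
      ≈⟨ +-identityˡ _ ⟩
    - f (w ∷ v ∷ vs) ∎
    where
    s : V
    s i = 1# * v i + w i
    second : ∀ u → f (u ∷ s ∷ vs) ≈ 1# * f (u ∷ v ∷ vs) + f (u ∷ w ∷ vs)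
    second u with F u
    ... | _ , _ , l , _ = l 1# v w vs

  -- A second `v` right behind the first is a repeat. For one further back, a swap moves the leading
  -- `v` past `w`, and induction applies to the contraction with `w`.
  alternating-annihilates : ∀ n f → Alternating (suc n) f → ∀ v → Annihilates v n (f ∘ (v ∷_))
  alternating-annihilates zero    f _ v = tt
  alternating-annihilates (suc n) f A@(F , _ , _ , rf) v =
      rf v
    , (λ w → annihilates-neg v n (λ vs → f (v ∷ w ∷ vs)) (λ vs → f (w ∷ v ∷ vs))
               (alternating-swap n f A v w) (alternating-annihilates n (f ∘ (w ∷_)) (F w) v))

  columns : ∀ n → (ℕ → V) → Vec V n
  columns n d = tabulate {n = n} (d ∘ toℕ)

  annihilated-shift : ∀ n f → Alternating n f → ∀ v → Annihilates v n f → ∀ (x : ℕ → Carrier) (d : ℕ → V) →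
    f (columns n (λ j i → x j * v i + d j i)) ≈ f (columns n d)
  annihilated-shift zero    f _ v _ x d = refl
  annihilated-shift (suc n) f (F , _ , lf , _) v (z , r) x d = begin
    f ((λ i → x 0 * v i + d 0 i) ∷ rest)      ≈⟨ lf (x 0) v (d 0) rest ⟩
    x 0 * f (v ∷ rest) + f (d 0 ∷ rest)       ≈⟨ +-congʳ (trans (*-congˡ (z rest)) (zeroʳ _)) ⟩
    0# + f (d 0 ∷ rest)                       ≈⟨ +-identityˡ _ ⟩
    f (d 0 ∷ rest)                            ≈⟨ annihilated-shift n (f ∘ (d 0 ∷_)) (F (d 0)) v (r (d 0)) (x ∘ suc) (d ∘ suc) ⟩
    f (columns (suc n) d)                     ∎
    where rest = columns n (λ j i → x (suc j) * v i + d (suc j) i)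

  -- Column 0 is `d 0`, and each later column is a multiple of `d 0` plus a convolution of the
  -- columns from 1 on. The form contracted with `d 0` ignores these multiples, which leaves the
  -- same problem with one column fewer.
  alternating-conv : ∀ n f → Alternating n f → ∀ u → u 0 ≈ 1# → ∀ (d : ℕ → V) →
    f (columns n (λ j i → conv u (λ l → d l i) j)) ≈ f (columns n d)
  alternating-conv zero    f _ u u₀ d = refl
  alternating-conv (suc n) f A@(F , cf , _ , _) u u₀ d = begin
    f ((λ i → u 0 * d 0 i) ∷ rest)  ≈⟨ cf rest (λ i → trans (*-congʳ u₀) (*-identityˡ (d 0 i))) ⟩
    f (d 0 ∷ rest)                  ≈⟨ annihilated-shift n (f ∘ (d 0 ∷_)) (F (d 0)) (d 0) (alternating-annihilates n f A (d 0))
                                         (u ∘ suc) (λ j i → conv u (λ l → d (suc l) i) j) ⟩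
    f (d 0 ∷ columns n (λ j i → conv u (λ l → d (suc l) i) j))
                                    ≈⟨ alternating-conv n (f ∘ (d 0 ∷_)) (F (d 0)) u u₀ (d ∘ suc) ⟩
    f (columns (suc n) d)           ∎
    where rest = columns n (λ j i → conv u (λ l → d l i) (suc j))

  -- Unwinding the contraction rule carries `h` through the arguments with one sign change per step;
  -- this is Laplace expansion along the row read by `h`.
  ∧-expand : ∀ {n} h (g : Form n) (d : Vector V (suc n)) → (h ∧ g) (tabulate d) ≈
    sum λ j → (- 1#) ^ toℕ j * h (d j) * g (tabulate (removeAt d j))
  ∧-expand {zero}  h g d = sym (trans (+-identityʳ _) (*-congʳ (*-identityˡ _)))
  ∧-expand {suc n} h g d = begin
    h (d zero) * g (tabulate (d ∘ suc)) - (h ∧ (g ∘ (d zero ∷_))) (tabulate (d ∘ suc))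
      ≈⟨ +-cong (sym (*-congʳ (*-identityˡ _))) (trans (-‿cong (∧-expand h (g ∘ (d zero ∷_)) (d ∘ suc))) (sym (-1*x≈-x _))) ⟩
    1# * h (d zero) * g (tabulate (d ∘ suc)) + (- 1#) * sum term
      ≈⟨ +-congˡ (trans (*-distribˡ-sum (- 1#) term)
           (sum-cong-≋ λ j → solve 4 (λ e p x y → e :* (p :* x :* y) := e :* p :* x :* y) refl (- 1#) ((- 1#) ^ toℕ j) (h (d (suc j))) (g (d zero ∷ tabulate (removeAt (d ∘ suc) j))))) ⟩
    sum (λ j → (- 1#) ^ toℕ j * h (d j) * g (tabulate (removeAt d j))) ∎
    where
    term : Fin (suc n) → Carrier
    term j = (- 1#) ^ toℕ j * h (d (suc j)) * g (d zero ∷ tabulate (removeAt (d ∘ suc) j))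

  -- The wedge of the coordinate functionals listed by `r`. Arbitrary `r` is needed since the
  -- recursion turns `toℕ` into `toℕ ∘ suc`.
  detForm : ∀ n → Vector ℕ n → Form n
  detForm zero    r = λ _ → 1#
  detForm (suc n) r = (λ v → v (r zero)) ∧ detForm n (r ∘ suc)

  detForm-alternating : ∀ n r → Alternating n (detForm n r)
  detForm-alternating zero    r = tt
  detForm-alternating (suc n) r = ∧-alternating (r zero) (detForm n (r ∘ suc)) (detForm-alternating n (r ∘ suc))

  detForm-det : ∀ n r (d : Vector V n) → detForm n r (tabulate d) ≈ det n (λ i j → d j (r i))
  detForm-det zero    r d = refl
  detForm-det (suc n) r d = trans (∧-expand (λ v → v (r zero)) (detForm n (r ∘ suc)) d)
    (sum-cong-≋ λ j → *-congˡ {x = (- 1#) ^ toℕ j * d j (r zero)} (detForm-det n (r ∘ suc) (removeAt d j)))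

  det-conv : ∀ n u → u 0 ≈ 1# → (M : ℕ → ℕ → Carrier) →
    det n (λ i j → conv u (M (toℕ i)) (toℕ j)) ≈ det n (λ i j → M (toℕ i) (toℕ j))
  det-conv n u u₀ M = begin
    det n (λ i j → conv u (M (toℕ i)) (toℕ j))
      ≈⟨ detForm-det n toℕ (λ j i → conv u (M i) (toℕ j)) ⟨
    detForm n toℕ (columns n (λ j i → conv u (M i) j))
      ≈⟨ alternating-conv n (detForm n toℕ) (detForm-alternating n toℕ) u u₀ (λ l i → M i l) ⟩
    detForm n toℕ (columns n (λ l i → M i l))
      ≈⟨ detForm-det n toℕ (λ j i → M i (toℕ j)) ⟩
    det n (λ i j → M (toℕ i) (toℕ j)) ∎

  -- Determinants whose first rows are antidiagonal unit rows

  δ : ℕ → ℕ → Carrier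
  δ zero    zero    = 1#
  δ zero    (suc _) = 0#
  δ (suc _) zero    = 0#
  δ (suc m) (suc n) = δ m n

  -- The index `m`, typed so that deleting it leaves `Fin (m ℕ.+ k)`.
  position : ∀ m k → Fin (suc (m ℕ.+ k))
  position zero    k = zero
  position (suc m) k = suc (position m k)

  toℕ-position : ∀ m k → toℕ (position m k) ≡ m
  toℕ-position zero    k = ≡.refl
  toℕ-position (suc m) k = ≡.cong suc (toℕ-position m k)

  punchIn-position : ∀ m {k} (b : Fin k) → punchIn (position m k) (m ↑ʳ b) ≡ suc (m ↑ʳ b)
  punchIn-position zero    b = ≡.refl
  punchIn-position (suc m) b = ≡.cong suc (punchIn-position m b)

  -- Deleting column `m` moves only columns from `m` on, and there a unit row with its one at
  -- `d < m` is zero before and after the move.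
  δ-punchIn : ∀ {d} m {k} → d < m → ∀ j → δ d (toℕ (punchIn (position m k) j)) ≡ δ d (toℕ j)
  δ-punchIn {zero}  (suc m) _         zero    = ≡.refl
  δ-punchIn {suc d} (suc m) _         zero    = ≡.refl
  δ-punchIn {zero}  (suc m) _         (suc j) = ≡.refl
  δ-punchIn {suc d} (suc m) (s≤s d<m) (suc j) = δ-punchIn m d<m j

  sum-δ : ∀ m k (X : Fin (suc (m ℕ.+ k)) → Carrier) → sum (λ j → δ m (toℕ j) * X j) ≈ X (position m k)
  sum-δ zero    k X = trans (+-cong (*-identityˡ _)
    (trans (sym (*-distribˡ-sum 0# (X ∘ suc))) (zeroˡ _))) (+-identityʳ _)
  sum-δ (suc m) k X = trans (+-cong (zeroˡ _) (sum-δ m k (X ∘ suc))) (+-identityˡ _)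

  -- With `suc m` unit rows the first has its one in column `m`. Expansion gives the sign of
  -- exponent `m` and a minor of the same kind with `m` unit rows; the exponents add up to the
  -- binomial coefficient.
  det-antidiagonal : ∀ m k (M : Matrix (m ℕ.+ k)) →
    (∀ i j → toℕ i < m → M i j ≈ δ (m ∸ suc (toℕ i)) (toℕ j)) →
    det (m ℕ.+ k) M ≈ (- 1#) ^ (m ℕ.C 2) * det k (λ a b → M (m ↑ʳ a) (m ↑ʳ b))
  det-antidiagonal zero    k M p = sym (*-identityˡ _)
  det-antidiagonal (suc m) k M p = begin
    sum (λ j → (- 1#) ^ toℕ j * M zero j * det (m ℕ.+ k) (minor M j))
      ≈⟨ sum-cong-≋ (λ j → trans (*-congʳ {x = det (m ℕ.+ k) (minor M j)} (trans (*-congˡ {x = (- 1#) ^ toℕ j} (p zero j (s≤s z≤n))) (*-comm _ _))) (*-assoc _ _ _)) ⟩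
    sum (λ j → δ m (toℕ j) * ((- 1#) ^ toℕ j * det (m ℕ.+ k) (minor M j)))
      ≈⟨ sum-δ m k (λ j → (- 1#) ^ toℕ j * det (m ℕ.+ k) (minor M j)) ⟩
    (- 1#) ^ toℕ q * det (m ℕ.+ k) (minor M q)
      ≈⟨ *-cong (reflexive (≡.cong ((- 1#) ^_) (toℕ-position m k))) (det-antidiagonal m k (minor M q) p′) ⟩
    (- 1#) ^ m * ((- 1#) ^ (m ℕ.C 2) * det k (λ a b → minor M q (m ↑ʳ a) (m ↑ʳ b)))
      ≈⟨ *-assoc _ _ _ ⟨
    (- 1#) ^ m * (- 1#) ^ (m ℕ.C 2) * det k (λ a b → minor M q (m ↑ʳ a) (m ↑ʳ b))
      ≈⟨ *-cong (trans (sym (^-homo-* (- 1#) m (m ℕ.C 2))) (reflexive (≡.cong ((- 1#) ^_) triangle)))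
                (det-cong k λ a b → reflexive (≡.cong (M (suc (m ↑ʳ a))) (punchIn-position m b))) ⟩
    (- 1#) ^ (suc m ℕ.C 2) * det k (λ a b → M (suc m ↑ʳ a) (suc m ↑ʳ b)) ∎
    where
    q = position m k
    triangle : m ℕ.+ m ℕ.C 2 ≡ suc m ℕ.C 2
    triangle = ≡.trans (≡.cong (ℕ._+ m ℕ.C 2) (≡.sym (ℕ.nC1≡n m))) (ℕ.nCk+nC[k+1]≡[n+1]C[k+1] m 1)
    p′ : ∀ i j → toℕ i < m → minor M q i j ≈ δ (m ∸ suc (toℕ i)) (toℕ j)
    p′ i j i<m = trans (p (suc i) (punchIn q j) (s≤s i<m))
      (reflexive (δ-punchIn m (ℕ.∸-monoʳ-< {m} (s≤s z≤n) i<m) j))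

-- The three-term recurrence at the level of single coefficients

module ThreeTermRecurrence {r ℓ} (R : CommutativeRing r ℓ) where
  open CommutativeRing R
  open IntegerSolver R using (solve; _:=_; con; _:+_; _:*_; _:-_)
  open import Relation.Binary.Reasoning.Setoid setoid

  -- With x = n and y = k, this is what remains of (n+4) C_{n+3} + (n+1) (1-t)² C_{n+1} = (2n+5)
  -- (1+t) C_{n+2} at t^k after all factorials are divided out.
  recurrence-core : ∀ x y → let n1 = 1# + x; n2 = 1# + n1; n3 = 1# + n2; k1 = 1# + y in
    (1# + n3) * (n2 * n2 * n3)
      + ((n1 - y) * (n2 - y) * (n2 - y) * (n3 - y) - (1# + 1#) * (y * k1 * (n2 - y) * (n3 - y)) + (y - 1#) * y * y * k1)
    ≈ (n3 + n2) * (n2 * ((n2 - y) * (n3 - y) + y * k1))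
  recurrence-core = solve 2 (λ x y →
    let one = con (ℤ.+ 1)
        n1 = one :+ x
        n2 = one :+ n1
        n3 = one :+ n2
        k1 = one :+ y
    in (one :+ n3) :* (n2 :* n2 :* n3)
         :+ ((n1 :- y) :* (n2 :- y) :* (n2 :- y) :* (n3 :- y) :- (one :+ one) :* (y :* k1 :* (n2 :- y) :* (n3 :- y)) :+ (y :- one) :* y :* y :* k1)
       := (n3 :+ n2) :* (n2 :* ((n2 :- y) :* (n3 :- y) :+ y :* k1))) refl

  -- Every term is a monomial multiple of the common factor `n1 * c`, with the differences `d1`,
  -- `d2`, `d3` as independent letters. The relations between the letters enter through the
  -- hypothesis on the cofactors alone.
  factored : ∀ n1 n2 n3 n4 y k1 d1 d2 d3 f u v →
    n4 * (n2 * n2 * n3) + (d1 * d2 * d2 * d3 - (1# + 1#) * (y * k1 * d2 * d3) + (y - 1#) * y * y * k1)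
      ≈ (n3 + n2) * (n2 * (d2 * d3 + y * k1)) →
    let f1 = n1 * f; f2 = n2 * f1; f3 = n3 * f2; w = k1 * u; g2 = d3 * v; g1 = d2 * g2; g0 = d1 * g1 in
    n4 * (f2 * f3 * (w * u * (g2 * v)))
      + n1 * (f * f1 * (w * u * (g0 * g1)) - (1# + 1#) * (f * f1 * (y * (w * w) * (g1 * g2)))
              + f * f1 * ((y - 1#) * y * y * (w * w) * (g2 * v)))
    ≈ (n3 + n2) * (f1 * f2 * (w * u * (g1 * g2)) + f1 * f2 * (y * (w * w) * (g2 * v)))
  factored n1 n2 n3 n4 y k1 d1 d2 d3 f u v core = begin
    _ ≈⟨ +-cong e1 (*-congˡ (+-cong (+-cong e2 (-‿cong (*-congˡ e3))) e4)) ⟩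
    n1 * (c * (n4 * (n2 * n2 * n3))) + n1 * (c * (d1 * d2 * d2 * d3) - (1# + 1#) * (c * (y * k1 * d2 * d3)) + c * ((y - 1#) * y * y * k1))
      ≈⟨ solve 6 (λ n1 c p q r s → n1 :* (c :* p) :+ n1 :* (c :* q :- (con (ℤ.+ 1) :+ con (ℤ.+ 1)) :* (c :* r) :+ c :* s)
                   := n1 :* c :* (p :+ (q :- (con (ℤ.+ 1) :+ con (ℤ.+ 1)) :* r :+ s))) refl n1 c _ _ _ _ ⟩
    n1 * c * (n4 * (n2 * n2 * n3) + (d1 * d2 * d2 * d3 - (1# + 1#) * (y * k1 * d2 * d3) + (y - 1#) * y * y * k1))
      ≈⟨ *-congˡ core ⟩
    n1 * c * ((n3 + n2) * (n2 * (d2 * d3 + y * k1)))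
      ≈⟨ solve 6 (λ n1 n2 c p q r → n1 :* c :* (p :* (n2 :* (q :+ r)))
                   := p :* (n1 :* n2 :* c :* q :+ n1 :* n2 :* c :* r)) refl n1 n2 c (n3 + n2) (d2 * d3) (y * k1) ⟩
    (n3 + n2) * (n1 * n2 * c * (d2 * d3) + n1 * n2 * c * (y * k1))
      ≈⟨ *-congˡ (+-cong e5 e6) ⟩
    _ ∎
    where
    f1 = n1 * f
    f2 = n2 * f1
    f3 = n3 * f2
    w = k1 * u
    g2 = d3 * v
    g1 = d2 * g2
    g0 = d1 * g1
    -- common factor of all terms of the recurrence
    c = f * f1 * (k1 * (u * u)) * (d3 * (v * v))
    e1 : n4 * (f2 * f3 * (w * u * (g2 * v))) ≈ n1 * (c * (n4 * (n2 * n2 * n3)))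
    e1 = solve 9 (λ n1 n2 n3 n4 k1 d3 f u v → let f1 = n1 :* f; f2 = n2 :* f1 in
      n4 :* (f2 :* (n3 :* f2) :* (k1 :* u :* u :* (d3 :* v :* v)))
        := n1 :* ((f :* f1 :* (k1 :* (u :* u)) :* (d3 :* (v :* v))) :* (n4 :* (n2 :* n2 :* n3)))) refl n1 n2 n3 n4 k1 d3 f u v
    e2 : f * f1 * (w * u * (g0 * g1)) ≈ c * (d1 * d2 * d2 * d3)
    e2 = solve 7 (λ ff k1 d1 d2 d3 u v →
      ff :* (k1 :* u :* u :* (d1 :* (d2 :* (d3 :* v)) :* (d2 :* (d3 :* v))))
        := ff :* (k1 :* (u :* u)) :* (d3 :* (v :* v)) :* (d1 :* d2 :* d2 :* d3)) refl (f * f1) k1 d1 d2 d3 u v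
    e3 : f * f1 * (y * (w * w) * (g1 * g2)) ≈ c * (y * k1 * d2 * d3)
    e3 = solve 7 (λ ff k1 y d2 d3 u v →
      ff :* (y :* (k1 :* u :* (k1 :* u)) :* (d2 :* (d3 :* v) :* (d3 :* v)))
        := ff :* (k1 :* (u :* u)) :* (d3 :* (v :* v)) :* (y :* k1 :* d2 :* d3)) refl (f * f1) k1 y d2 d3 u v
    e4 : f * f1 * ((y - 1#) * y * y * (w * w) * (g2 * v)) ≈ c * ((y - 1#) * y * y * k1)
    e4 = solve 6 (λ ff k1 p d3 u v →
      ff :* (p :* (k1 :* u :* (k1 :* u)) :* (d3 :* v :* v))
        := ff :* (k1 :* (u :* u)) :* (d3 :* (v :* v)) :* (p :* k1)) refl (f * f1) k1 ((y - 1#) * y * y) d3 u v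
    e5 : n1 * n2 * c * (d2 * d3) ≈ f1 * f2 * (w * u * (g1 * g2))
    e5 = solve 8 (λ n1 n2 k1 d2 d3 f u v → let f1 = n1 :* f; f2 = n2 :* f1 in
      n1 :* n2 :* (f :* f1 :* (k1 :* (u :* u)) :* (d3 :* (v :* v))) :* (d2 :* d3)
        := f1 :* f2 :* (k1 :* u :* u :* (d2 :* (d3 :* v) :* (d3 :* v)))) refl n1 n2 k1 d2 d3 f u v
    e6 : n1 * n2 * c * (y * k1) ≈ f1 * f2 * (y * (w * w) * (g2 * v))
    e6 = solve 8 (λ n1 n2 k1 y d3 f u v → let f1 = n1 :* f; f2 = n2 :* f1 in
      n1 :* n2 :* (f :* f1 :* (k1 :* (u :* u)) :* (d3 :* (v :* v))) :* (y :* k1)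
        := f1 :* f2 :* (y :* (k1 :* u :* (k1 :* u)) :* (d3 :* v :* v))) refl n1 n2 k1 y d3 f u v

  -- Here x = n, y = k, f = n!, u = 1/(k+1)!, v = 1/(n+3−k)!, so that w = 1/k! and gᵢ = 1/(n+i−k)!, while cᵢ, tcᵢ and
  -- ttcᵢ are the coefficients of tᵏ in C_{n+1+i}, t C_{n+1+i} and t² C_{n+1+i}.
  three-term : ∀ x y f u v {w g0 g1 g2 c0 c1 c2 tc0 tc1 ttc0} →
    let n1 = 1# + x; n2 = 1# + n1; n3 = 1# + n2; f1 = n1 * f; f2 = n2 * f1; f3 = n3 * f2 in
    w ≡ (1# + y) * u → g2 ≡ (n3 - y) * v → g1 ≡ (n2 - y) * g2 → g0 ≡ (n1 - y) * g1 →
    c0 ≡ f * f1 * (w * u * (g0 * g1)) → c1 ≡ f1 * f2 * (w * u * (g1 * g2)) → c2 ≡ f2 * f3 * (w * u * (g2 * v)) →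
    tc0 ≡ f * f1 * (y * (w * w) * (g1 * g2)) → tc1 ≡ f1 * f2 * (y * (w * w) * (g2 * v)) →
    ttc0 ≡ f * f1 * ((y - 1#) * y * y * (w * w) * (g2 * v)) →
    (1# + n3) * c2 + n1 * (c0 - (1# + 1#) * tc0 + ttc0) ≈ (n3 + n2) * (c1 + tc1)
  three-term x y f u v ≡.refl ≡.refl ≡.refl ≡.refl ≡.refl ≡.refl ≡.refl ≡.refl ≡.refl ≡.refl =
    factored _ _ _ _ _ _ _ _ _ f u v (recurrence-core x y)

-- The reciprocal of the Narayana series

module NarayanaReciprocal {r ℓ} (R : CommutativeRing r ℓ) where
  open CommutativeRing R
  open Convolution R

  module FromRecurrence
    (ι-torsionFree : ∀ n x → ι (suc n) * x ≈ 0# → x ≈ 0#)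
    (τ : Carrier)
    (τ-cancel : ∀ x y → τ * x ≈ τ * y → x ≈ y)
    (𝒞 : ℕ → Carrier)
    (𝒞₀ : 𝒞 0 ≈ 1#)
    (𝒞₁ : 𝒞 1 ≈ 1#)
    (𝒞₂ : 𝒞 2 ≈ (1# + τ) * 𝒞 1)
    (𝒞-recurrence : ∀ n →
      ι (4 ℕ.+ n) * 𝒞 (3 ℕ.+ n) + ι (1 ℕ.+ n) * (𝒞 (1 ℕ.+ n) - (1# + 1#) * (τ * 𝒞 (1 ℕ.+ n)) + τ * (τ * 𝒞 (1 ℕ.+ n)))
        ≈ (ι (3 ℕ.+ n) + ι (2 ℕ.+ n)) * (𝒞 (2 ℕ.+ n) + τ * 𝒞 (2 ℕ.+ n)))
    where
    open IntegerSolver R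
    module 𝕊 = CommutativeRing powerSeries
    module 𝕊Solver = IntegerSolver powerSeries
    open import Relation.Binary.Reasoning.Setoid setoid

    quadratic : Carrier → Carrier → Carrier → ℕ → Carrier
    quadratic q₀ q₁ q₂ 0 = q₀
    quadratic q₀ q₁ q₂ 1 = q₁
    quadratic q₀ q₁ q₂ 2 = q₂
    quadratic q₀ q₁ q₂ (suc (suc (suc _))) = 0#

    conv-quadratic : ∀ s q₀ q₁ q₂ n →
      conv s (quadratic q₀ q₁ q₂) (2 ℕ.+ n) ≈ s (2 ℕ.+ n) * q₀ + (s (1 ℕ.+ n) * q₁ + s n * q₂)
    conv-quadratic s q₀ q₁ q₂ zero    = refl
    conv-quadratic s q₀ q₁ q₂ (suc n) =
      +-congˡ (+-congˡ (trans (+-congˡ (conv-zeroʳ s n)) (+-identityʳ _)))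

    -- Lets the solver use a hypothesis `u ≈ v`: it checks an unconditional identity with the
    -- explicit cofactor `k`.
    ≈-modulo : ∀ {x y} k {u v} → u ≈ v → x ≈ y + k * (u - v) → x ≈ y
    ≈-modulo k u≈v p = trans p (trans (+-congˡ (trans (*-congˡ (trans (+-congʳ u≈v) (-‿inverseʳ _))) (zeroʳ k))) (+-identityʳ _))

    reciprocal : ℕ → Carrier
    reciprocal 0             = 1#
    reciprocal 1             = - 1#
    reciprocal (suc (suc n)) = - (τ * 𝒞 (suc n))

    tx𝒞 : ℕ → Carrier
    tx𝒞 zero    = 0#
    tx𝒞 (suc n) = τ * 𝒞 n

    discriminant : ℕ → Carrier
    discriminant = quadratic 1# (- ((1# + 1#) * (1# + τ))) ((1# - τ) * (1# - τ))

    -- Half of θ of the discriminant, written out so that nothing is divided by 2.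
    halfθ : ℕ → Carrier
    halfθ = quadratic 0# (- (1# + τ)) ((1# - τ) * (1# - τ))

    -- The series 1 + (τ - 1) x - 2 τ x 𝒞, with 𝒞 0 = 1 inserted in the coefficient of x.
    root : ℕ → Carrier
    root 0             = 1#
    root 1             = - (1# + τ)
    root (suc (suc n)) = - ((1# + 1#) * (τ * 𝒞 (suc n)))

    𝟙 : ∀ {n} → Polynomial n
    𝟙 = con ℤ.1ℤ

    𝟘 : ∀ {n} → Polynomial n
    𝟘 = con ℤ.0ℤ

    root-≋ : root ≋ (reciprocal 𝕊.- tx𝒞)
    root-≋ 0 = solve 0 (𝟙 := 𝟙 :- 𝟘) refl
    root-≋ 1 = ≈-modulo τ 𝒞₀ (solve 2 (λ t c → :- (𝟙 :+ t) := :- 𝟙 :- t :* c :+ t :* (c :- 𝟙)) refl τ (𝒞 0))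
    root-≋ (suc (suc n)) = solve 2 (λ t c → :- ((𝟙 :+ 𝟙) :* (t :* c)) := :- (t :* c) :- t :* c) refl τ (𝒞 (suc n))

    root-equation : conv (θ root) discriminant ≋ conv root halfθ
    root-equation 0 = solve 0 (𝟘 :* 𝟙 :* 𝟙 := 𝟙 :* 𝟘) refl
    root-equation 1 = solve 1 (λ t →
        (𝟙 :+ 𝟘) :* (:- (𝟙 :+ t)) :* 𝟙 :+ 𝟘 :* 𝟙 :* (:- ((𝟙 :+ 𝟙) :* (𝟙 :+ t)))
          := :- (𝟙 :+ t) :* 𝟘 :+ 𝟙 :* (:- (𝟙 :+ t))) refl τ
    -- The term n · `root n` contributes -2nτ · 𝒞 (n-1), hence the cofactors -4τ here and -6τ for n
    -- = 3.
    root-equation 2 = ≈-modulo (- ((1# + 1#) * (1# + 1#) * τ)) 𝒞₁ (solve 2 (λ t c → let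
        y₁ = :- (𝟙 :+ t)
        y₂ = :- ((𝟙 :+ 𝟙) :* (t :* c))
        q₁ = :- ((𝟙 :+ 𝟙) :* (𝟙 :+ t))
        q₂ = (𝟙 :- t) :* (𝟙 :- t)
      in (𝟙 :+ (𝟙 :+ 𝟘)) :* y₂ :* 𝟙 :+ ((𝟙 :+ 𝟘) :* y₁ :* q₁ :+ 𝟘 :* 𝟙 :* q₂)
          := (y₂ :* 𝟘 :+ (y₁ :* y₁ :+ 𝟙 :* q₂)) :+ (:- ((𝟙 :+ 𝟙) :* (𝟙 :+ 𝟙) :* t)) :* (c :- 𝟙)) refl τ (𝒞 1))
    root-equation 3 = begin
      conv (θ root) discriminant 3
        ≈⟨ conv-quadratic (θ root) _ _ _ 1 ⟩
      _ ≈⟨ ≈-modulo (- ((1# + 1# + 1#) * (1# + 1#) * τ)) 𝒞₂ (solve 3 (λ t c d → let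
             y₁ = :- (𝟙 :+ t)
             y₂ = :- ((𝟙 :+ 𝟙) :* (t :* c))
             y₃ = :- ((𝟙 :+ 𝟙) :* (t :* d))
             q₁ = :- ((𝟙 :+ 𝟙) :* (𝟙 :+ t))
             q₂ = (𝟙 :- t) :* (𝟙 :- t)
           in (𝟙 :+ (𝟙 :+ (𝟙 :+ 𝟘))) :* y₃ :* 𝟙 :+ ((𝟙 :+ (𝟙 :+ 𝟘)) :* y₂ :* q₁ :+ (𝟙 :+ 𝟘) :* y₁ :* q₂)
               := (y₃ :* 𝟘 :+ (y₂ :* y₁ :+ y₁ :* q₂))
                  :+ (:- ((𝟙 :+ 𝟙 :+ 𝟙) :* (𝟙 :+ 𝟙) :* t)) :* (d :- (𝟙 :+ t) :* c)) refl τ (𝒞 1) (𝒞 2)) ⟩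
      _ ≈⟨ conv-quadratic root _ _ _ 1 ⟨
      conv root halfθ 3 ∎
    -- From index 4 on, all three coefficients of `root` involved have the uniform form -2τ𝒞, so the
    -- equation is -2τ times the recurrence.
    root-equation (suc (suc (suc (suc n)))) = begin
      conv (θ root) discriminant (4 ℕ.+ n)
        ≈⟨ conv-quadratic (θ root) _ _ _ (2 ℕ.+ n) ⟩
      _ ≈⟨ ≈-modulo (- ((1# + 1#) * τ)) (𝒞-recurrence n) (solve 5 (λ t x b c d → let
             n₁ = 𝟙 :+ x
             n₂ = 𝟙 :+ n₁
             n₃ = 𝟙 :+ n₂
             n₄ = 𝟙 :+ n₃
             y₂ = :- ((𝟙 :+ 𝟙) :* (t :* b))
             y₃ = :- ((𝟙 :+ 𝟙) :* (t :* c))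
             y₄ = :- ((𝟙 :+ 𝟙) :* (t :* d))
             q₁ = :- ((𝟙 :+ 𝟙) :* (𝟙 :+ t))
             q₂ = (𝟙 :- t) :* (𝟙 :- t)
           in n₄ :* y₄ :* 𝟙 :+ (n₃ :* y₃ :* q₁ :+ n₂ :* y₂ :* q₂)
               := (y₄ :* 𝟘 :+ (y₃ :* (:- (𝟙 :+ t)) :+ y₂ :* q₂))
                  :+ (:- ((𝟙 :+ 𝟙) :* t)) :* ((n₄ :* d :+ n₁ :* (b :- (𝟙 :+ 𝟙) :* (t :* b) :+ t :* (t :* b)))
                                               :- (n₃ :+ n₂) :* (c :+ t :* c)))
             refl τ (ι n) (𝒞 (1 ℕ.+ n)) (𝒞 (2 ℕ.+ n)) (𝒞 (3 ℕ.+ n))) ⟩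
      _ ≈⟨ conv-quadratic root _ _ _ (2 ℕ.+ n) ⟨
      conv root halfθ (4 ℕ.+ n) ∎

    -- If all coefficients before n > 0 vanish, coefficient n of the equation reads n · `u n` ·
    -- `q 0` = `u n` · `k 0`, that is n · `u n` = 0.
    θ-zero-unique : ∀ u q k → q 0 ≈ 1# → k 0 ≈ 0# → u 0 ≈ 0# → conv (θ u) q ≋ conv u k → ∀ n → u n ≈ 0#
    θ-zero-unique u q k q₀ k₀ u₀ eq = ℕ.<-rec _ step
      where
      step : ∀ n → (∀ {i} → i < n → u i ≈ 0#) → u n ≈ 0#
      step zero    _  = u₀
      step (suc n) ih = ι-torsionFree n (u (suc n)) (begin
        θ u (suc n)               ≈⟨ *-identityʳ _ ⟨
        θ u (suc n) * 1#          ≈⟨ *-congˡ q₀ ⟨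
        θ u (suc n) * q 0         ≈⟨ conv-leading (θ u) q (suc n) (λ i i<n → trans (*-congˡ (ih i<n)) (zeroʳ _)) ⟨
        conv (θ u) q (suc n)      ≈⟨ eq (suc n) ⟩
        conv u k (suc n)          ≈⟨ conv-leading u k (suc n) (λ i i<n → ih i<n) ⟩
        u (suc n) * k 0           ≈⟨ *-congˡ k₀ ⟩
        u (suc n) * 0#            ≈⟨ zeroʳ _ ⟩
        0#                        ∎)

    θ-discriminant : θ discriminant ≋ (halfθ 𝕊.+ halfθ)
    θ-discriminant 0 = solve 0 (𝟘 :* 𝟙 := 𝟘 :+ 𝟘) refl
    θ-discriminant 1 = solve 1 (λ t → (𝟙 :+ 𝟘) :* (:- ((𝟙 :+ 𝟙) :* (𝟙 :+ t))) := :- (𝟙 :+ t) :+ :- (𝟙 :+ t)) refl τ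
    θ-discriminant 2 = solve 1 (λ q → (𝟙 :+ (𝟙 :+ 𝟘)) :* q := q :+ q) refl ((1# - τ) * (1# - τ))
    θ-discriminant (suc (suc (suc n))) = trans (zeroʳ _) (sym (+-identityʳ 0#))

    root-squared : conv root root ≋ discriminant
    root-squared n = begin
      conv root root n                                       ≈⟨ solve 2 (λ a b → a := (a :- b) :+ b) refl _ (discriminant n) ⟩
      (conv root root n - discriminant n) + discriminant n   ≈⟨ +-congʳ (vanishes n) ⟩
      0# + discriminant n                                    ≈⟨ +-identityˡ _ ⟩
      discriminant n                                         ∎
      where
      defect = (root 𝕊.* root) 𝕊.- discriminant
      θ-defect : θ defect 𝕊.≈ (θ root 𝕊.* root 𝕊.+ root 𝕊.* θ root) 𝕊.- (halfθ 𝕊.+ halfθ)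
      θ-defect n = begin
        ι n * (conv root root n - discriminant n)            ≈⟨ solve 3 (λ i a b → i :* (a :- b) := i :* a :- i :* b) refl (ι n) _ _ ⟩
        θ (conv root root) n - θ discriminant n              ≈⟨ +-cong (θ-leibniz root root n) (-‿cong (θ-discriminant n)) ⟩
        _                                                    ∎
      equation : (θ defect 𝕊.* discriminant) 𝕊.≈ (defect 𝕊.* (halfθ 𝕊.+ halfθ))
      -- With h = `halfθ`, `root-equation` turns Q θ(y²) = 2y (Q θy) into 2h y², while θQ = 2h.
      equation = 𝕊.trans (𝕊.*-congʳ {x = discriminant} θ-defect)
        (𝕊.trans (𝕊Solver.solve 4 (λ y z q h → (z ⊗ y ⊕ y ⊗ z ⊖ (h ⊕ h)) ⊗ q ⊜ (y ⊗ (z ⊗ q) ⊕ y ⊗ (z ⊗ q)) ⊖ (h ⊕ h) ⊗ q)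
                   𝕊.refl root (θ root) discriminant halfθ)
        (𝕊.trans (𝕊.+-congʳ {x = 𝕊.- ((halfθ 𝕊.+ halfθ) 𝕊.* discriminant)}
                   (𝕊.+-cong (𝕊.*-congˡ {x = root} root-equation) (𝕊.*-congˡ {x = root} root-equation)))
        (𝕊Solver.solve 3 (λ y q h → (y ⊗ (y ⊗ h) ⊕ y ⊗ (y ⊗ h)) ⊖ (h ⊕ h) ⊗ q ⊜ (y ⊗ y ⊖ q) ⊗ (h ⊕ h))
           𝕊.refl root discriminant halfθ)))
        where open 𝕊Solver using () renaming (_:*_ to _⊗_; _:+_ to _⊕_; _:-_ to _⊖_; _:=_ to _⊜_)
      vanishes : ∀ n → defect n ≈ 0#
      vanishes = θ-zero-unique defect discriminant (halfθ 𝕊.+ halfθ) refl (+-identityʳ 0#)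
        (solve 0 (𝟙 :* 𝟙 :- 𝟙 := 𝟘) refl) equation

    linear : ℕ → Carrier
    linear = quadratic 1# (τ - 1#) 0#

    linear-≋ : linear ≋ (reciprocal 𝕊.+ tx𝒞)
    linear-≋ 0 = sym (+-identityʳ 1#)
    linear-≋ 1 = ≈-modulo (- τ) 𝒞₀ (solve 2 (λ t c → t :- 𝟙 := :- 𝟙 :+ t :* c :+ (:- t) :* (c :- 𝟙)) refl τ (𝒞 0))
    linear-≋ 2 = sym (-‿inverseˡ _)
    linear-≋ (suc (suc (suc n))) = sym (-‿inverseˡ _)

    -- The square of 1 + (τ - 1) x differs from the discriminant only at x, by 2(τ - 1) + 2(1 + τ) =
    -- 4τ. Reading it at `suc n` strips the factor x.
    linear-squared : ∀ n → conv linear linear (suc n) - discriminant (suc n) ≈ ι 4 * (τ * one n)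
    linear-squared 0 = solve 1 (λ t → ((t :- 𝟙) :* 𝟙 :+ 𝟙 :* (t :- 𝟙)) :- (:- ((𝟙 :+ 𝟙) :* (𝟙 :+ t)))
      := (𝟙 :+ (𝟙 :+ (𝟙 :+ (𝟙 :+ 𝟘)))) :* (t :* 𝟙)) refl τ
    linear-squared 1 = solve 1 (λ t → (𝟘 :* 𝟙 :+ ((t :- 𝟙) :* (t :- 𝟙) :+ 𝟙 :* 𝟘)) :- (𝟙 :- t) :* (𝟙 :- t)
      := (𝟙 :+ (𝟙 :+ (𝟙 :+ (𝟙 :+ 𝟘)))) :* (t :* 𝟘)) refl τ
    linear-squared (suc (suc n)) = trans (+-congʳ (conv-quadratic linear 1# (τ - 1#) 0# (suc n)))
      (trans (+-congʳ (+-congˡ (+-congʳ (*-congʳ (tail n)))))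
        (solve 2 (λ t x → (𝟘 :* 𝟙 :+ (𝟘 :* (t :- 𝟙) :+ x :* 𝟘)) :- 𝟘
          := (𝟙 :+ (𝟙 :+ (𝟙 :+ (𝟙 :+ 𝟘)))) :* (t :* 𝟘)) refl τ (linear (suc n))))
      where
      tail : ∀ n → linear (2 ℕ.+ n) ≈ 0#
      tail zero    = refl
      tail (suc _) = refl

    polarisation : conv reciprocal tx𝒞 𝕊.+ conv reciprocal tx𝒞 𝕊.+ (conv reciprocal tx𝒞 𝕊.+ conv reciprocal tx𝒞)
      𝕊.≈ (linear 𝕊.* linear) 𝕊.- discriminant
    polarisation = 𝕊.trans
      (𝕊Solver.solve 2 (λ g a → (g ⊗ a ⊕ g ⊗ a) ⊕ (g ⊗ a ⊕ g ⊗ a) ⊜ (g ⊕ a) ⊗ (g ⊕ a) ⊖ (g ⊖ a) ⊗ (g ⊖ a)) 𝕊.refl reciprocal tx𝒞)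
      (𝕊.+-cong (𝕊.*-cong (𝕊.sym linear-≋) (𝕊.sym linear-≋))
        (𝕊.-‿cong (𝕊.trans (𝕊.*-cong (𝕊.sym root-≋) (𝕊.sym root-≋)) root-squared)))
      where open 𝕊Solver using () renaming (_:*_ to _⊗_; _:+_ to _⊕_; _:-_ to _⊖_; _:=_ to _⊜_)

    -- Coefficient `suc n` of `polarisation` is this equation multiplied by 4τ; torsion-freeness
    -- removes the 4 and `τ-cancel` the τ.
    reciprocal-conv : conv reciprocal 𝒞 ≋ one
    reciprocal-conv n = τ-cancel _ _ (begin
      τ * conv reciprocal 𝒞 n                 ≈⟨ solve 2 (λ a b → a := (a :- b) :+ b) refl (τ * conv reciprocal 𝒞 n) (τ * one n) ⟩
      (τ * conv reciprocal 𝒞 n - τ * one n) + τ * one n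
                                              ≈⟨ +-congʳ (ι-torsionFree 3 _ four) ⟩
      0# + τ * one n                          ≈⟨ +-identityˡ _ ⟩
      τ * one n                               ∎)
      where
      shift : conv reciprocal tx𝒞 (suc n) ≈ τ * conv reciprocal 𝒞 n
      shift = begin
        reciprocal (suc n) * 0# + conv reciprocal (λ k → τ * 𝒞 k) n  ≈⟨ +-cong (zeroʳ _) (conv-cong (λ _ → refl) (λ k → *-comm τ (𝒞 k)) n) ⟩
        0# + conv reciprocal (λ k → 𝒞 k * τ) n                       ≈⟨ +-identityˡ _ ⟩
        conv reciprocal (λ k → 𝒞 k * τ) n                            ≈⟨ conv-scaleʳ reciprocal 𝒞 τ n ⟩
        conv reciprocal 𝒞 n * τ                                      ≈⟨ *-comm _ τ ⟩
        τ * conv reciprocal 𝒞 n                                      ∎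
      four : ι 4 * (τ * conv reciprocal 𝒞 n - τ * one n) ≈ 0#
      four = begin
        ι 4 * (τ * conv reciprocal 𝒞 n - τ * one n)
          ≈⟨ solve 2 (λ x y → (𝟙 :+ (𝟙 :+ (𝟙 :+ (𝟙 :+ 𝟘)))) :* (x :- y) := ((x :+ x) :+ (x :+ x)) :- (𝟙 :+ (𝟙 :+ (𝟙 :+ (𝟙 :+ 𝟘)))) :* y)
               refl (τ * conv reciprocal 𝒞 n) (τ * one n) ⟩
        _ ≈⟨ +-congʳ (+-cong (+-cong shift shift) (+-cong shift shift)) ⟨
        _ ≈⟨ +-congʳ (polarisation (suc n)) ⟩
        _ ≈⟨ +-congʳ (linear-squared n) ⟩
        ι 4 * (τ * one n) - ι 4 * (τ * one n) ≈⟨ -‿inverseʳ _ ⟩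
        0# ∎

-- Reducing the Hankel matrix with the reciprocal series

module HankelDuality {r ℓ} (R : CommutativeRing r ℓ) where
  open CommutativeRing R
  open Convolution R

  module WithReciprocal
    (τ : Carrier)
    (𝒞 g : ℕ → Carrier)
    (𝒞₀ : 𝒞 0 ≈ 1#)
    (g₀ : g 0 ≈ 1#)
    (g-tail : ∀ n → g (suc (suc n)) ≈ - (τ * 𝒞 (suc n)))
    (g-conv : ∀ n → conv g 𝒞 n ≈ one n)
    where
    open DeterminantProperties R
    open RawSemiringDefs (RawRing.rawSemiring rawRing) using (_^_)
    open import Relation.Binary.Reasoning.Setoid setoid

    -- The coefficients of x^m 𝒞, which realise the convention that 𝒞 is zero at negative indices.
    delayed : ℕ → ℕ → Carrier
    delayed zero    k       = 𝒞 k
    delayed (suc m) zero    = 0#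
    delayed (suc m) (suc k) = delayed m k

    delayed-early : ∀ {m k} → k < m → delayed m k ≡ 0#
    delayed-early {suc m} {zero}  _         = ≡.refl
    delayed-early {suc m} {suc k} (s≤s k<m) = delayed-early k<m

    delayed-late : ∀ m k → delayed m (m ℕ.+ k) ≡ 𝒞 k
    delayed-late zero    k = ≡.refl
    delayed-late (suc m) k = delayed-late m k

    -- For i ≤ m, row i of the Hankel matrix is itself a delayed copy of 𝒞, with delay m - i.
    delayed-∸ : ∀ {m} i l → i ≤ m → delayed m (i ℕ.+ l) ≡ delayed (m ∸ i) l
    delayed-∸ zero    l _         = ≡.refl
    delayed-∸ (suc i) l (s≤s i≤m) = delayed-∸ i l i≤m

    g-delayed : ∀ d j → conv g (delayed d) j ≈ δ d j
    g-delayed zero    zero    = g-conv 0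
    g-delayed zero    (suc j) = g-conv (suc j)
    g-delayed (suc d) zero    = zeroʳ (g 0)
    g-delayed (suc d) (suc j) = trans (+-cong (zeroʳ (g (suc j))) (g-delayed d j))
      (+-identityˡ (δ d j))

    -- The vanishing coefficient a+j+2 of g 𝒞 is cut behind index `a` of 𝒞. The late terms are the
    -- left side; in the early ones g has index at least j+2, where `g-tail` applies. This is why
    -- the column is `suc j`.
    g-advanced : ∀ a j → conv g (λ l → 𝒞 (suc a ℕ.+ l)) (suc j)
      ≈ conv 𝒞 (λ r → τ * 𝒞 (suc j ℕ.+ r)) a
    g-advanced a j = begin
      x                                        ≈⟨ solve 2 (λ x y → x := (y :+ x) :- y) refl x y ⟩
      (y + x) - y                              ≈⟨ +-congʳ (trans (sym (conv-split g 𝒞 a (suc j))) (g-conv (suc a ℕ.+ suc j))) ⟩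
      0# - y                                   ≈⟨ +-identityˡ _ ⟩
      - y                                      ≈⟨ -‿cong (conv-cong (λ r → g-tail (j ℕ.+ r)) (λ _ → refl) a) ⟩
      - conv (λ r → - u r) 𝒞 a                 ≈⟨ -‿cong (-‿distribˡ-* u 𝒞 a) ⟨
      - (- conv u 𝒞 a)                         ≈⟨ -‿involutive _ ⟩
      conv u 𝒞 a                               ≈⟨ conv-comm u 𝒞 a ⟩
      conv 𝒞 u a                               ∎
      where
      open IntegerSolver R using (solve; _:+_; _:-_; _:=_)
      open import Algebra.Properties.Ring (CommutativeRing.ring powerSeries) using (-‿distribˡ-*)
      open import Algebra.Properties.Ring ring using (-‿involutive)
      x = conv g (λ l → 𝒞 (suc a ℕ.+ l)) (suc j)
      y = conv (λ r → g (suc (suc j) ℕ.+ r)) 𝒞 a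
      u : ℕ → Carrier
      u r = τ * 𝒞 (suc j ℕ.+ r)

    module _ (m : ℕ) where
      hankel : ℕ → ℕ → Carrier
      hankel i j = delayed m (i ℕ.+ j)

      reduced : ℕ → ℕ → Carrier
      reduced i = conv g (hankel i)

      reduced-early : ∀ i j → i < suc m → reduced i j ≈ δ (suc m ∸ suc i) j
      reduced-early i j (s≤s i≤m) = trans
        (conv-cong {u = g} (λ _ → refl) (λ l → reflexive (delayed-∸ i l i≤m)) j)
        (g-delayed (m ∸ i) j)

      reduced-late : ∀ a b → reduced (suc m ℕ.+ a) (suc m ℕ.+ b) ≈ conv 𝒞 (λ r → τ * 𝒞 (suc m ℕ.+ b ℕ.+ r)) a
      reduced-late a b = trans
        (conv-cong {u = g} (λ _ → refl) (λ l → reflexive (≡.trans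
          (≡.cong (delayed m) (≡.trans (≡.cong (ℕ._+ l) (≡.sym (ℕ.+-suc m a))) (ℕ.+-assoc m (suc a) l)))
          (delayed-late m (suc a ℕ.+ l)))) (suc m ℕ.+ b))
        (g-advanced a (m ℕ.+ b))

      det-hankel : ∀ k → det (suc m ℕ.+ k) (λ i j → hankel (toℕ i) (toℕ j)) ≈
        (- 1#) ^ (suc m ℕ.C 2) * τ ^ k * det k (λ i j → 𝒞 (toℕ i ℕ.+ toℕ j ℕ.+ suc m))
      det-hankel k = begin
        det n (λ i j → hankel (toℕ i) (toℕ j))
          ≈⟨ det-conv n g g₀ hankel ⟨
        det n (λ i j → reduced (toℕ i) (toℕ j))
          ≈⟨ det-antidiagonal (suc m) k (λ i j → reduced (toℕ i) (toℕ j)) (λ i j → reduced-early (toℕ i) (toℕ j)) ⟩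
        sign * det k (λ a b → reduced (toℕ (suc m ↑ʳ a)) (toℕ (suc m ↑ʳ b)))
          ≈⟨ *-congˡ {x = sign} (det-cong k λ a b → trans
               (reflexive (≡.cong₂ reduced (Fin.toℕ-↑ʳ (suc m) a) (Fin.toℕ-↑ʳ (suc m) b)))
               (reduced-late (toℕ a) (toℕ b))) ⟩
        sign * det k (λ a b → conv 𝒞 (λ r → τ * 𝒞 (suc m ℕ.+ toℕ b ℕ.+ r)) (toℕ a))
          -- The convolution runs along the row index; transposing makes it a column operation, to
          -- which `det-conv` applies with 𝒞 itself, as 𝒞 0 = 1.
          ≈⟨ *-congˡ {x = sign} (det-transpose k λ b a → conv 𝒞 (λ r → τ * 𝒞 (suc m ℕ.+ toℕ b ℕ.+ r)) (toℕ a)) ⟩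
        sign * det k (λ b a → conv 𝒞 (λ r → τ * 𝒞 (suc m ℕ.+ toℕ b ℕ.+ r)) (toℕ a))
          ≈⟨ *-congˡ {x = sign} (det-conv k 𝒞 𝒞₀ (λ b r → τ * 𝒞 (suc m ℕ.+ b ℕ.+ r))) ⟩
        sign * det k (λ b a → τ * 𝒞 (suc m ℕ.+ toℕ b ℕ.+ toℕ a))
          ≈⟨ *-congˡ {x = sign} (det-scale k τ λ b a → 𝒞 (suc m ℕ.+ toℕ b ℕ.+ toℕ a)) ⟩
        sign * (τ ^ k * det k (λ b a → 𝒞 (suc m ℕ.+ toℕ b ℕ.+ toℕ a)))
          ≈⟨ *-congˡ {x = sign} (*-congˡ {x = τ ^ k} (det-cong k λ b a → reflexive (≡.cong 𝒞
               (≡.trans (ℕ.+-assoc (suc m) (toℕ b) (toℕ a)) (ℕ.+-comm (suc m) (toℕ b ℕ.+ toℕ a)))))) ⟩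
        sign * (τ ^ k * det k (λ i j → 𝒞 (toℕ i ℕ.+ toℕ j ℕ.+ suc m)))
          ≈⟨ *-assoc sign (τ ^ k) (det k (λ i j → 𝒞 (toℕ i ℕ.+ toℕ j ℕ.+ suc m))) ⟨
        sign * τ ^ k * det k (λ i j → 𝒞 (toℕ i ℕ.+ toℕ j ℕ.+ suc m)) ∎
        where
        n = suc m ℕ.+ k
        sign = (- 1#) ^ (suc m ℕ.C 2)

-- Polynomials as a commutative ring, via their coefficient sequences

module ℚConv = Convolution ℚ.+-*-commutativeRing
open ℚConv using () renaming (conv to convℚ; ι to ιℚ)

coeff-+ : ∀ p q k → coeff (p +ₚ q) k ≡ coeff p k ℚ.+ coeff q k
coeff-+ []      q       k       = ≡.sym (ℚ.+-identityˡ _)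
coeff-+ (a ∷ p) []      k       = ≡.sym (ℚ.+-identityʳ _)
coeff-+ (a ∷ p) (b ∷ q) zero    = ≡.refl
coeff-+ (a ∷ p) (b ∷ q) (suc k) = coeff-+ p q k

coeff-neg : ∀ p k → coeff (map ℚ.-_ p) k ≡ ℚ.- coeff p k
coeff-neg []      k       = ≡.refl
coeff-neg (a ∷ p) zero    = ≡.refl
coeff-neg (a ∷ p) (suc k) = coeff-neg p k

coeff-scale : ∀ a q k → coeff (map (a ℚ.*_) q) k ≡ a ℚ.* coeff q k
coeff-scale a []      k       = ≡.sym (ℚ.*-zeroʳ a)
coeff-scale a (b ∷ q) zero    = ≡.refl
coeff-scale a (b ∷ q) (suc k) = coeff-scale a q k

coeff-* : ∀ p q k → coeff (p *ₚ q) k ≡ convℚ (coeff p) (coeff q) k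
coeff-* []      q k       = ≡.sym (ℚConv.conv-zeroˡ _ (coeff q) k λ _ _ → ≡.refl)
coeff-* (a ∷ p) q zero    = ≡.trans (coeff-+ (map (a ℚ.*_) q) _ 0)
  (≡.trans (ℚ.+-identityʳ _) (coeff-scale a q 0))
coeff-* (a ∷ p) q (suc k) = begin
  coeff (map (a ℚ.*_) q +ₚ (0ℚ ∷ (p *ₚ q))) (suc k)      ≡⟨ coeff-+ (map (a ℚ.*_) q) _ (suc k) ⟩
  coeff (map (a ℚ.*_) q) (suc k) ℚ.+ coeff (p *ₚ q) k    ≡⟨ ≡.cong₂ ℚ._+_ (coeff-scale a q (suc k)) (coeff-* p q k) ⟩
  a ℚ.* coeff q (suc k) ℚ.+ convℚ (coeff p) (coeff q) k  ≡⟨ ℚ.+-comm (a ℚ.* coeff q (suc k)) _ ⟩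
  convℚ (coeff p) (coeff q) k ℚ.+ a ℚ.* coeff q (suc k)  ≡⟨ ℚConv.conv-suc (coeff (a ∷ p)) (coeff q) k ⟨
  convℚ (coeff (a ∷ p)) (coeff q) (suc k)                ∎
  where open ≡.≡-Reasoning

-- Equality of polynomials is coefficientwise by definition, so injectivity is `id`, and the ring
-- laws descend from power series over ℚ.
coeff-isRingMonomorphism : IsRingMonomorphism polyRing (CommutativeRing.rawRing ℚConv.powerSeries) coeff
coeff-isRingMonomorphism = record
  { isRingHomomorphism = record
    { isSemiringHomomorphism = record
      { isNearSemiringHomomorphism = record
        { +-isMonoidHomomorphism = record
          { isMagmaHomomorphism = record
            { isRelHomomorphism = record { cong = id }
            ; homo = coeff-+
            }
          ; ε-homo = λ _ → ≡.refl
          }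
        ; *-homo = coeff-*
        }
      ; 1#-homo = λ { zero → ≡.refl ; (suc _) → ≡.refl }
      }
    ; -‿homo = coeff-neg
    }
  ; injective = id
  }

-- The operations of `polyRing` are kept, so the general determinant results speak about the very
-- determinants in `D`.
polyCommutativeRing : CommutativeRing 0ℓ 0ℓ
polyCommutativeRing = record
  { RawRing polyRing
  ; isCommutativeRing = isCommutativeRing (CommutativeRing.isCommutativeRing ℚConv.powerSeries)
  }
  where open import Algebra.Morphism.RingMonomorphism coeff-isRingMonomorphism using (isCommutativeRing)

module ℚ[t] = CommutativeRing polyCommutativeRing
module Polyᶜ = Convolution polyCommutativeRing
open Polyᶜ using (ι)

coeff-t*-zero : ∀ p → coeff (t *ₚ p) 0 ≡ 0ℚ
coeff-t*-zero p = ≡.trans (coeff-* t p 0) (ℚ.*-zeroˡ (coeff p 0))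

coeff-t*-suc : ∀ p k → coeff (t *ₚ p) (suc k) ≡ coeff p k
coeff-t*-suc p k = begin
  coeff (t *ₚ p) (suc k)                                        ≡⟨ coeff-* t p (suc k) ⟩
  convℚ (coeff t) (coeff p) (suc k)                             ≡⟨ ℚConv.conv-suc (coeff t) (coeff p) k ⟩
  convℚ (coeff (1ℚ ∷ [])) (coeff p) k ℚ.+ 0ℚ ℚ.* coeff p (suc k) ≡⟨ ≡.cong₂ ℚ._+_ (coeff-* (1ℚ ∷ []) p k) (≡.sym (ℚ.*-zeroˡ (coeff p (suc k)))) ⟨
  coeff ((1ℚ ∷ []) *ₚ p) k ℚ.+ 0ℚ                               ≡⟨ ℚ.+-identityʳ _ ⟩
  coeff ((1ℚ ∷ []) *ₚ p) k                                      ≡⟨ ℚ[t].*-identityˡ p k ⟩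
  coeff p k                                                     ∎
  where open ≡.≡-Reasoning

coeff-ι* : ∀ n p k → coeff (ι n *ₚ p) k ≡ ιℚ n ℚ.* coeff p k
coeff-ι* zero    p k = ≡.sym (ℚ.*-zeroˡ (coeff p k))
coeff-ι* (suc n) p k = begin
  coeff ((ℚ[t].1# +ₚ ι n) *ₚ p) k                   ≡⟨ ℚ[t].distribʳ p ℚ[t].1# (ι n) k ⟩
  coeff (ℚ[t].1# *ₚ p +ₚ ι n *ₚ p) k                ≡⟨ coeff-+ (ℚ[t].1# *ₚ p) _ k ⟩
  coeff (ℚ[t].1# *ₚ p) k ℚ.+ coeff (ι n *ₚ p) k     ≡⟨ ≡.cong₂ ℚ._+_ (ℚ[t].*-identityˡ p k) (coeff-ι* n p k) ⟩
  coeff p k ℚ.+ ιℚ n ℚ.* coeff p k                  ≡⟨ ≡.cong (ℚ._+ (ιℚ n ℚ.* coeff p k)) (ℚ.*-identityˡ (coeff p k)) ⟨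
  1ℚ ℚ.* coeff p k ℚ.+ ιℚ n ℚ.* coeff p k           ≡⟨ ℚ.*-distribʳ-+ (coeff p k) 1ℚ (ιℚ n) ⟨
  ιℚ (suc n) ℚ.* coeff p k                          ∎
  where open ≡.≡-Reasoning

t-cancel : ∀ p q → t *ₚ p ≈ₚ t *ₚ q → p ≈ₚ q
t-cancel p q eq k = ≡.trans (≡.sym (coeff-t*-suc p k)) (≡.trans (eq (suc k)) (coeff-t*-suc q k))

-- Narayana numbers in terms of factorials

module NarayanaNumbers where
  open import Data.Rational.Base using (_+_; _*_; _-_; toℚᵘ; fromℚᵘ)
  open ≡ using (refl; sym; trans; cong; cong₂)
  open ℚConv using () renaming (ι to ιℚ)
  open import Algebra.Properties.Semiring.Mult (CommutativeRing.semiring ℚ.+-*-commutativeRing) using (×-homo-+; ×1-homo-*)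
  open IntegerSolver ℚ.+-*-commutativeRing using (solve; _:=_; con; _:+_; _:*_; _:-_)
  open ThreeTermRecurrence ℚ.+-*-commutativeRing using (three-term)

  toℚᵘ-ι : ∀ n → toℚᵘ (ιℚ n) ℚᵘ.≃ mkℚᵘ (+ n) 0
  toℚᵘ-ι zero    = ℚᵘ.≃-refl
  toℚᵘ-ι (suc n) = begin
    toℚᵘ (1ℚ + ιℚ n)                    ≈⟨ ℚ.toℚᵘ-homo-+ 1ℚ (ιℚ n) ⟩
    toℚᵘ 1ℚ ℚᵘ.+ toℚᵘ (ιℚ n)            ≈⟨ ℚᵘ.+-congʳ (toℚᵘ 1ℚ) (toℚᵘ-ι n) ⟩
    mkℚᵘ (+ 1) 0 ℚᵘ.+ mkℚᵘ (+ n) 0      ≈⟨ *≡* (ℤSolver.+-*-Solver.solve 1 (λ x → (1ᶻ :*ᶻ 1ᶻ :+ᶻ x :*ᶻ 1ᶻ) :*ᶻ 1ᶻ :=ᶻ (1ᶻ :+ᶻ x) :*ᶻ (1ᶻ :*ᶻ 1ᶻ)) refl (+ n)) ⟩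
    mkℚᵘ (+ suc n) 0                    ∎
    where
    open ℚᵘ.≃-Reasoning
    open ℤSolver.+-*-Solver using () renaming (con to conᶻ; _:*_ to _:*ᶻ_; _:+_ to _:+ᶻ_; _:=_ to _:=ᶻ_)
    1ᶻ = conᶻ (+ 1)

  /*ι : ∀ a k → (+ a ℚ./ suc k) * ιℚ (suc k) ≡ ιℚ a
  /*ι a k = ℚ.toℚᵘ-injective (begin
    toℚᵘ (fromℚᵘ (mkℚᵘ (+ a) k) * ιℚ (suc k))          ≈⟨ ℚ.toℚᵘ-homo-* (fromℚᵘ (mkℚᵘ (+ a) k)) (ιℚ (suc k)) ⟩
    toℚᵘ (fromℚᵘ (mkℚᵘ (+ a) k)) ℚᵘ.* toℚᵘ (ιℚ (suc k)) ≈⟨ ℚᵘ.*-cong (ℚ.toℚᵘ-fromℚᵘ (mkℚᵘ (+ a) k)) (toℚᵘ-ι (suc k)) ⟩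
    mkℚᵘ (+ a) k ℚᵘ.* mkℚᵘ (+ suc k) 0                 ≈⟨ *≡* (ℤSolver.+-*-Solver.solve 2 (λ x d → (x :*ᶻ d) :*ᶻ conᶻ (+ 1) :=ᶻ x :*ᶻ (d :*ᶻ conᶻ (+ 1))) refl (+ a) (+ suc k)) ⟩
    mkℚᵘ (+ a) 0                                       ≈⟨ toℚᵘ-ι a ⟨
    toℚᵘ (ιℚ a)                                        ∎)
    where
    open ℚᵘ.≃-Reasoning
    open ℤSolver.+-*-Solver using () renaming (con to conᶻ; _:*_ to _:*ᶻ_; _:=_ to _:=ᶻ_)

  inv : ℕ → ℚ
  inv k = + 1 ℚ./ suc k

  ι-cancel : ∀ k x y → ιℚ (suc k) * x ≡ ιℚ (suc k) * y → x ≡ y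
  ι-cancel k x y eq = trans (sym (undo x)) (trans (cong (inv k *_) eq) (undo y))
    where
    undo : ∀ z → inv k * (ιℚ (suc k) * z) ≡ z
    undo z = trans (sym (ℚ.*-assoc (inv k) _ z)) (trans (cong (_* z) (/*ι 1 k)) (ℚ.*-identityˡ z))

  open ≡.≡-Reasoning

  fact : ℕ → ℚ
  fact zero    = 1ℚ
  fact (suc n) = ιℚ (suc n) * fact n

  invFact : ℕ → ℚ
  invFact zero    = 1ℚ
  invFact (suc n) = inv n * invFact n

  -- 1/(n − k)!, which vanishes for k > n.
  invFact∸ : ℕ → ℕ → ℚ
  invFact∸ n       zero    = invFact n
  invFact∸ zero    (suc k) = 0ℚ
  invFact∸ (suc n) (suc k) = invFact∸ n k

  invFact-suc : ∀ n → invFact n ≡ ιℚ (suc n) * invFact (suc n)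
  invFact-suc n = sym (begin
    ιℚ (suc n) * (inv n * invFact n)   ≡⟨ solve 3 (λ a b c → a :* (b :* c) := b :* a :* c) refl (ιℚ (suc n)) (inv n) (invFact n) ⟩
    inv n * ιℚ (suc n) * invFact n     ≡⟨ cong (_* invFact n) (/*ι 1 n) ⟩
    1ℚ * invFact n                     ≡⟨ ℚ.*-identityˡ _ ⟩
    invFact n                          ∎)

  fact-invFact : ∀ n → fact n * invFact n ≡ 1ℚ
  fact-invFact zero    = refl
  fact-invFact (suc n) = begin
    ιℚ (suc n) * fact n * invFact (suc n)    ≡⟨ solve 3 (λ a b c → a :* b :* c := b :* (a :* c)) refl (ιℚ (suc n)) (fact n) (invFact (suc n)) ⟩
    fact n * (ιℚ (suc n) * invFact (suc n))  ≡⟨ cong (fact n *_) (invFact-suc n) ⟨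
    fact n * invFact n                       ≡⟨ fact-invFact n ⟩
    1ℚ                                       ∎

  -- True for every `k`: at k = n+1 the factor is zero, and beyond it both inverse factorials are.
  -- Thus no recurrence below needs a case split on the range of `k`.
  invFact∸-step : ∀ n k → invFact∸ n k ≡ (ιℚ (suc n) - ιℚ k) * invFact∸ (suc n) k
  invFact∸-step n       zero          = trans (invFact-suc n)
    (cong (_* invFact (suc n)) (sym (ℚ.+-identityʳ (ιℚ (suc n)))))
  invFact∸-step zero    (suc zero)    = refl
  invFact∸-step zero    (suc (suc k)) = sym (ℚ.*-zeroʳ (ιℚ 1 - ιℚ (suc (suc k))))
  invFact∸-step (suc n) (suc k)       = trans (invFact∸-step n k)
    (cong (_* invFact∸ (suc n) k) (solve 2 (λ x y → x :- y := (con (+ 1) :+ x) :- (con (+ 1) :+ y)) refl (ιℚ (suc n)) (ιℚ k)))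

  binomial : ℕ → ℕ → ℚ
  binomial n k = fact n * (invFact k * invFact∸ n k)

  binomial-suc : ∀ n k → binomial n k + binomial n (suc k) ≡ binomial (suc n) (suc k)
  binomial-suc n k = begin
    fact n * (invFact k * invFact∸ n k) + fact n * (invFact (suc k) * invFact∸ n (suc k))
      ≡⟨ cong₂ (λ x y → fact n * (x * invFact∸ n k) + fact n * (invFact (suc k) * y)) (invFact-suc k) (invFact∸-step n (suc k)) ⟩
    fact n * (ιℚ (suc k) * invFact (suc k) * invFact∸ n k) + fact n * (invFact (suc k) * ((ιℚ (suc n) - ιℚ (suc k)) * invFact∸ n k))
      ≡⟨ solve 5 (λ f u v x y → f :* (y :* u :* v) :+ f :* (u :* ((x :- y) :* v)) := x :* f :* (u :* v)) refl
           (fact n) (invFact (suc k)) (invFact∸ n k) (ιℚ (suc n)) (ιℚ (suc k)) ⟩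
    ιℚ (suc n) * fact n * (invFact (suc k) * invFact∸ n k) ∎

  ι-binomial : ∀ n k → ιℚ (n C k) ≡ binomial n k
  ι-binomial n       zero    = sym (trans (cong (fact n *_) (ℚ.*-identityˡ (invFact n))) (fact-invFact n))
  ι-binomial zero    (suc k) = sym (trans (cong (1ℚ *_) (ℚ.*-zeroʳ (invFact (suc k)))) (ℚ.*-zeroʳ 1ℚ))
  ι-binomial (suc n) (suc k) = begin
    ιℚ (suc n C suc k)                  ≡⟨ cong ιℚ (ℕ.nCk+nC[k+1]≡[n+1]C[k+1] n k) ⟨
    ιℚ (n C k ℕ.+ n C suc k)            ≡⟨ ×-homo-+ 1ℚ (n C k) (n C suc k) ⟩
    ιℚ (n C k) + ιℚ (n C suc k)         ≡⟨ cong₂ _+_ (ι-binomial n k) (ι-binomial n (suc k)) ⟩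
    binomial n k + binomial n (suc k)   ≡⟨ binomial-suc n k ⟩
    binomial (suc n) (suc k)            ∎

  narayana⁺ : ℕ → Poly
  narayana⁺ n = narayana (+ suc n)

  narayanaNumber : ℕ → ℕ → ℚ
  narayanaNumber n k = fact n * fact (suc n) * (invFact k * invFact (suc k) * (invFact∸ n k * invFact∸ (suc n) k))

  coeff-applyUpTo : ∀ f n k → (n ≤ k → f k ≡ 0ℚ) → coeff (applyUpTo f n) k ≡ f k
  coeff-applyUpTo f zero    k       z = sym (z z≤n)
  coeff-applyUpTo f (suc n) zero    z = refl
  coeff-applyUpTo f (suc n) (suc k) z = coeff-applyUpTo (f ∘ suc) n k (z ∘ s≤s)

  coeff-narayana⁺ : ∀ n k → coeff (narayana⁺ n) k ≡ narayanaNumber n k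
  -- Past the end of the list the entry formula stays valid, because `n C k` is zero there.
  coeff-narayana⁺ n k = trans (coeff-applyUpTo (λ j → + ((n C j) ℕ.* (suc n C j)) ℚ./ suc j) (suc n) k (λ n<k →
      ι-cancel k _ _ (begin
        ιℚ (suc k) * (+ ((n C k) ℕ.* (suc n C k)) ℚ./ suc k)  ≡⟨ clear ⟩
        ιℚ ((n C k) ℕ.* (suc n C k))                          ≡⟨ cong (λ x → ιℚ (x ℕ.* (suc n C k))) (ℕ.k>n⇒nCk≡0 n<k) ⟩
        0ℚ                                                    ≡⟨ ℚ.*-zeroʳ (ιℚ (suc k)) ⟨
        ιℚ (suc k) * 0ℚ                                       ∎)))
    (ι-cancel k _ _ (begin
      ιℚ (suc k) * (+ ((n C k) ℕ.* (suc n C k)) ℚ./ suc k)    ≡⟨ clear ⟩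
      ιℚ ((n C k) ℕ.* (suc n C k))                            ≡⟨ ×1-homo-* (n C k) (suc n C k) ⟩
      ιℚ (n C k) * ιℚ (suc n C k)                             ≡⟨ cong₂ _*_ (ι-binomial n k) (ι-binomial (suc n) k) ⟩
      binomial n k * binomial (suc n) k                       ≡⟨ cong (λ x → fact n * (x * invFact∸ n k) * binomial (suc n) k) (invFact-suc k) ⟩
      fact n * (ιℚ (suc k) * invFact (suc k) * invFact∸ n k) * binomial (suc n) k
        ≡⟨ solve 7 (λ f f′ u u′ v v′ i → f :* (i :* u′ :* v) :* (f′ :* (u :* v′)) := i :* (f :* f′ :* (u :* u′ :* (v :* v′)))) refl
             (fact n) (fact (suc n)) (invFact k) (invFact (suc k)) (invFact∸ n k) (invFact∸ (suc n) k) (ιℚ (suc k)) ⟩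
      ιℚ (suc k) * narayanaNumber n k                         ∎))
    where
    clear : ιℚ (suc k) * (+ ((n C k) ℕ.* (suc n C k)) ℚ./ suc k) ≡ ιℚ ((n C k) ℕ.* (suc n C k))
    clear = trans (ℚ.*-comm (ιℚ (suc k)) _) (/*ι ((n C k) ℕ.* (suc n C k)) k)

  -- Multiplication by t lowers k by one. Writing 1/(k-1)! as k/k! keeps the formula at `k` and
  -- makes it vanish at k = 0, as it must.
  coeff-t*narayana⁺ : ∀ n k → coeff (t *ₚ narayana⁺ n) k ≡
    fact n * fact (suc n) * (ιℚ k * (invFact k * invFact k) * (invFact∸ (suc n) k * invFact∸ (suc (suc n)) k))
  coeff-t*narayana⁺ n zero    = trans (coeff-t*-zero (narayana⁺ n))
    (solve 3 (λ f x y → con (+ 0) := f :* (con (+ 0) :* x :* y)) refl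
      (fact n * fact (suc n)) (1ℚ * 1ℚ) (invFact (suc n) * invFact (suc (suc n))))
  coeff-t*narayana⁺ n (suc k) = begin
    coeff (t *ₚ narayana⁺ n) (suc k)    ≡⟨ coeff-t*-suc (narayana⁺ n) k ⟩
    coeff (narayana⁺ n) k               ≡⟨ coeff-narayana⁺ n k ⟩
    fact n * fact (suc n) * (invFact k * invFact (suc k) * (invFact∸ n k * invFact∸ (suc n) k))
      ≡⟨ cong (λ x → fact n * fact (suc n) * (x * invFact (suc k) * (invFact∸ n k * invFact∸ (suc n) k))) (invFact-suc k) ⟩
    fact n * fact (suc n) * (ιℚ (suc k) * invFact (suc k) * invFact (suc k) * (invFact∸ n k * invFact∸ (suc n) k))
      ≡⟨ cong (λ x → fact n * fact (suc n) * (x * (invFact∸ n k * invFact∸ (suc n) k))) (ℚ.*-assoc (ιℚ (suc k)) _ _) ⟩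
    fact n * fact (suc n) * (ιℚ (suc k) * (invFact (suc k) * invFact (suc k)) * (invFact∸ n k * invFact∸ (suc n) k)) ∎

  -- Likewise 1/((k-2)! (k-1)!) becomes (k-1) k² / k!², which vanishes at k = 0 and k = 1.
  coeff-t*t*narayana⁺ : ∀ n k → coeff (t *ₚ (t *ₚ narayana⁺ n)) k ≡
    fact n * fact (suc n) * ((ιℚ k - 1ℚ) * ιℚ k * ιℚ k * (invFact k * invFact k) * (invFact∸ (suc (suc n)) k * invFact∸ (suc (suc (suc n))) k))
  coeff-t*t*narayana⁺ n zero    = trans (coeff-t*-zero (t *ₚ narayana⁺ n))
    (solve 3 (λ f x y → con (+ 0) := f :* ((con (+ 0) :- con (+ 1)) :* con (+ 0) :* con (+ 0) :* x :* y)) refl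
      (fact n * fact (suc n)) (1ℚ * 1ℚ) (invFact (suc (suc n)) * invFact (suc (suc (suc n)))))
  coeff-t*t*narayana⁺ n (suc k) = begin
    coeff (t *ₚ (t *ₚ narayana⁺ n)) (suc k)  ≡⟨ coeff-t*-suc (t *ₚ narayana⁺ n) k ⟩
    coeff (t *ₚ narayana⁺ n) k               ≡⟨ coeff-t*narayana⁺ n k ⟩
    fact n * fact (suc n) * (ιℚ k * (invFact k * invFact k) * (invFact∸ (suc n) k * invFact∸ (suc (suc n)) k))
      ≡⟨ cong (λ x → fact n * fact (suc n) * (ιℚ k * (x * x) * (invFact∸ (suc n) k * invFact∸ (suc (suc n)) k))) (invFact-suc k) ⟩
    fact n * fact (suc n) * (ιℚ k * (ιℚ (suc k) * invFact (suc k) * (ιℚ (suc k) * invFact (suc k))) * (invFact∸ (suc n) k * invFact∸ (suc (suc n)) k))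
      ≡⟨ solve 4 (λ f i u v → f :* (i :* ((con (+ 1) :+ i) :* u :* ((con (+ 1) :+ i) :* u)) :* v)
                           := f :* (((con (+ 1) :+ i) :- con (+ 1)) :* (con (+ 1) :+ i) :* (con (+ 1) :+ i) :* (u :* u) :* v)) refl
           (fact n * fact (suc n)) (ιℚ k) (invFact (suc k)) (invFact∸ (suc n) k * invFact∸ (suc (suc n)) k) ⟩
    _ ∎

  narayanaNumber-recurrence : ∀ n k →
    ιℚ (4 ℕ.+ n) * coeff (narayana⁺ (2 ℕ.+ n)) k
      + ιℚ (1 ℕ.+ n) * (coeff (narayana⁺ n) k - (1ℚ + 1ℚ) * coeff (t *ₚ narayana⁺ n) k + coeff (t *ₚ (t *ₚ narayana⁺ n)) k)
    ≡ (ιℚ (3 ℕ.+ n) + ιℚ (2 ℕ.+ n)) * (coeff (narayana⁺ (1 ℕ.+ n)) k + coeff (t *ₚ narayana⁺ (1 ℕ.+ n)) k)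
  narayanaNumber-recurrence n k = three-term (ιℚ n) (ιℚ k) (fact n) (invFact (suc k)) (invFact∸ (3 ℕ.+ n) k)
    (invFact-suc k) (invFact∸-step (2 ℕ.+ n) k) (invFact∸-step (1 ℕ.+ n) k) (invFact∸-step n k)
    (coeff-narayana⁺ n k) (coeff-narayana⁺ (1 ℕ.+ n) k) (coeff-narayana⁺ (2 ℕ.+ n) k)
    (coeff-t*narayana⁺ n k) (coeff-t*narayana⁺ (1 ℕ.+ n) k) (coeff-t*t*narayana⁺ n k)

-- The Narayana polynomials as an instance, and the determinant identity

open import Algebra.Definitions.RawSemiring (RawRing.rawSemiring polyRing) using (_^_)
open RawRing polyRing using (_≈_; _*_; -_; 0#; 1#)
open ℚConv using () renaming (ι to ιℚ)
open NarayanaNumbers using (narayana⁺; narayanaNumber-recurrence; ι-cancel)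

coeff-2* : ∀ p k → coeff ((1# +ₚ 1#) *ₚ p) k ≡ (1ℚ ℚ.+ 1ℚ) ℚ.* coeff p k
coeff-2* p k = begin
  coeff ((1# +ₚ 1#) *ₚ p) k                    ≡⟨ ℚ[t].distribʳ p 1# 1# k ⟩
  coeff (1# *ₚ p +ₚ 1# *ₚ p) k                 ≡⟨ coeff-+ (1# *ₚ p) (1# *ₚ p) k ⟩
  coeff (1# *ₚ p) k ℚ.+ coeff (1# *ₚ p) k      ≡⟨ ≡.cong₂ ℚ._+_ (ℚ[t].*-identityˡ p k) (ℚ[t].*-identityˡ p k) ⟩
  coeff p k ℚ.+ coeff p k                      ≡⟨ ≡.cong₂ ℚ._+_ (ℚ.*-identityˡ (coeff p k)) (ℚ.*-identityˡ (coeff p k)) ⟨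
  1ℚ ℚ.* coeff p k ℚ.+ 1ℚ ℚ.* coeff p k        ≡⟨ ℚ.*-distribʳ-+ (coeff p k) 1ℚ 1ℚ ⟨
  (1ℚ ℚ.+ 1ℚ) ℚ.* coeff p k                    ∎
  where open ≡.≡-Reasoning

coeff-combination : ∀ i j p q r s k →
  coeff (ι i *ₚ p +ₚ ι j *ₚ (q +ₚ - ((1# +ₚ 1#) *ₚ r) +ₚ s)) k
  ≡ ιℚ i ℚ.* coeff p k ℚ.+ ιℚ j ℚ.* (coeff q k ℚ.- (1ℚ ℚ.+ 1ℚ) ℚ.* coeff r k ℚ.+ coeff s k)
coeff-combination i j p q r s k = begin
  coeff (ι i *ₚ p +ₚ ι j *ₚ w) k                  ≡⟨ coeff-+ (ι i *ₚ p) (ι j *ₚ w) k ⟩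
  coeff (ι i *ₚ p) k ℚ.+ coeff (ι j *ₚ w) k       ≡⟨ ≡.cong₂ ℚ._+_ (coeff-ι* i p k) (coeff-ι* j w k) ⟩
  ιℚ i ℚ.* coeff p k ℚ.+ ιℚ j ℚ.* coeff w k       ≡⟨ ≡.cong (λ x → ιℚ i ℚ.* coeff p k ℚ.+ ιℚ j ℚ.* x) inner ⟩
  _                                               ∎
  where
  open ≡.≡-Reasoning
  v = (1# +ₚ 1#) *ₚ r
  w = q +ₚ - v +ₚ s
  inner : coeff w k ≡ coeff q k ℚ.- (1ℚ ℚ.+ 1ℚ) ℚ.* coeff r k ℚ.+ coeff s k
  inner = begin
    coeff (q +ₚ - v +ₚ s) k                     ≡⟨ coeff-+ (q +ₚ - v) s k ⟩
    coeff (q +ₚ - v) k ℚ.+ coeff s k            ≡⟨ ≡.cong (ℚ._+ coeff s k) (coeff-+ q (- v) k) ⟩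
    coeff q k ℚ.+ coeff (- v) k ℚ.+ coeff s k   ≡⟨ ≡.cong (λ x → coeff q k ℚ.+ x ℚ.+ coeff s k) (≡.trans (coeff-neg v k) (≡.cong ℚ.-_ (coeff-2* r k))) ⟩
    _                                           ∎

coeff-ι+ι* : ∀ i j p q k →
  coeff ((ι i +ₚ ι j) *ₚ (p +ₚ q)) k ≡ (ιℚ i ℚ.+ ιℚ j) ℚ.* (coeff p k ℚ.+ coeff q k)
coeff-ι+ι* i j p q k = begin
  coeff ((ι i +ₚ ι j) *ₚ w) k                 ≡⟨ ℚ[t].distribʳ w (ι i) (ι j) k ⟩
  coeff (ι i *ₚ w +ₚ ι j *ₚ w) k              ≡⟨ coeff-+ (ι i *ₚ w) (ι j *ₚ w) k ⟩
  coeff (ι i *ₚ w) k ℚ.+ coeff (ι j *ₚ w) k   ≡⟨ ≡.cong₂ ℚ._+_ (coeff-ι* i w k) (coeff-ι* j w k) ⟩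
  ιℚ i ℚ.* coeff w k ℚ.+ ιℚ j ℚ.* coeff w k   ≡⟨ ℚ.*-distribʳ-+ (coeff w k) (ιℚ i) (ιℚ j) ⟨
  (ιℚ i ℚ.+ ιℚ j) ℚ.* coeff w k               ≡⟨ ≡.cong ((ιℚ i ℚ.+ ιℚ j) ℚ.*_) (coeff-+ p q k) ⟩
  _                                           ∎
  where
  open ≡.≡-Reasoning
  w = p +ₚ q

narayana-recurrence : ∀ n →
  ι (4 ℕ.+ n) *ₚ narayana⁺ (2 ℕ.+ n)
    +ₚ ι (1 ℕ.+ n) *ₚ (narayana⁺ n +ₚ - ((1# +ₚ 1#) *ₚ (t *ₚ narayana⁺ n)) +ₚ t *ₚ (t *ₚ narayana⁺ n))
  ≈ (ι (3 ℕ.+ n) +ₚ ι (2 ℕ.+ n)) *ₚ (narayana⁺ (1 ℕ.+ n) +ₚ t *ₚ narayana⁺ (1 ℕ.+ n))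
narayana-recurrence n k = ≡.trans
  (coeff-combination (4 ℕ.+ n) (1 ℕ.+ n) (narayana⁺ (2 ℕ.+ n)) (narayana⁺ n) (t *ₚ narayana⁺ n) (t *ₚ (t *ₚ narayana⁺ n)) k)
  (≡.trans (narayanaNumber-recurrence n k)
    (≡.sym (coeff-ι+ι* (3 ℕ.+ n) (2 ℕ.+ n) (narayana⁺ (1 ℕ.+ n)) (t *ₚ narayana⁺ (1 ℕ.+ n)) k)))

narayana⁰ : ℕ → Poly
narayana⁰ n = narayana (+ n)

poly-ι-torsionFree : ∀ n p → ι (suc n) *ₚ p ≈ 0# → p ≈ 0#
poly-ι-torsionFree n p eq k = ι-cancel n (coeff p k) 0ℚ
  (≡.trans (≡.sym (coeff-ι* (suc n) p k)) (≡.trans (eq k) (≡.sym (ℚ.*-zeroʳ (ιℚ (suc n))))))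

narayana-one : narayana⁰ 1 ≈ 1#
narayana-one zero    = ≡.refl
narayana-one (suc _) = ≡.refl

narayana-two : narayana⁰ 2 ≈ (1# +ₚ t) *ₚ narayana⁰ 1
narayana-two 0 = ≡.refl
narayana-two 1 = ≡.refl
narayana-two 2 = ≡.refl
narayana-two (suc (suc (suc _))) = ≡.refl

module Narayana = NarayanaReciprocal.FromRecurrence polyCommutativeRing poly-ι-torsionFree t t-cancel narayana⁰
  (λ _ → ≡.refl) narayana-one narayana-two narayana-recurrence

module Duality = HankelDuality.WithReciprocal polyCommutativeRing t narayana⁰ Narayana.reciprocal
  (λ _ → ≡.refl) (λ _ → ≡.refl) (λ _ _ → ≡.refl) Narayana.reciprocal-conv
open Duality using (delayed; delayed-early; hankel; det-hankel)
open DeterminantProperties polyCommutativeRing using (det; det-cong; det-zeroRow)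

narayana-⊖ : ∀ k m → narayana (+ k ℤ.+ (ℤ.- + m)) ≡ delayed m k
narayana-⊖ k m = ≡.trans (≡.cong narayana (ℤ.m-n≡m⊖n k m)) (go k m)
  where
  go : ∀ k m → narayana (k ℤ.⊖ m) ≡ delayed m k
  go k       zero    = ≡.refl
  go zero    (suc m) = ≡.refl
  go (suc k) (suc m) = ≡.trans (≡.cong narayana (ℤ.[1+m]⊖[1+n]≡m⊖n k m)) (go k m)

D-delayed : ∀ m n → D (ℤ.- (+ m)) n ≈ det n (λ i j → hankel m (toℕ i) (toℕ j))
D-delayed m n = det-cong n λ i j k → ≡.cong (λ p → coeff p k) (narayana-⊖ (toℕ i ℕ.+ toℕ j) m)

-- The first row, present as 1 ≤ n, consists of C_{j-m} with j < n ≤ m and is therefore zero.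
D-vanishes : ∀ m n → 1 ≤ n → n ≤ m → D (ℤ.- (+ m)) n ≈ 0#
D-vanishes m (suc n) _ n<m k = ≡.trans (D-delayed m (suc n) k)
  (det-zeroRow n (λ i j → hankel m (toℕ i) (toℕ j))
    (λ j k → ≡.cong (λ p → coeff p k) (delayed-early (ℕ.≤-trans (Fin.toℕ<n j) n<m))) k)

D-reflect : ∀ m k → D (ℤ.- (+ m)) (suc m ℕ.+ k) ≈ (- 1#) ^ (suc m C 2) * t ^ k * D (+ suc m) k
D-reflect m k i = ≡.trans (D-delayed m (suc m ℕ.+ k) i) (det-hankel m k i)

theorem8 : ∀ (m : ℕ) → 1 ≤ m →
    (∀ (n : ℕ) → 1 ≤ n → n ≤ m → D (ℤ.- (+ m)) n ≈ 0#) ×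
    (∀ (n : ℕ) → m ℕ.+ 1 ≤ n →
    D (ℤ.- (+ m)) n ≈
    (- 1#) ^ ((m ℕ.+ 1) C 2) * t ^ (n ∸ (m ℕ.+ 1)) * D (+ (m ℕ.+ 1)) (n ∸ (m ℕ.+ 1)))
theorem8 m _ = D-vanishes m , large
  where
  large : ∀ n → m ℕ.+ 1 ≤ n → D (ℤ.- (+ m)) n ≈
    (- 1#) ^ ((m ℕ.+ 1) C 2) * t ^ (n ∸ (m ℕ.+ 1)) * D (+ (m ℕ.+ 1)) (n ∸ (m ℕ.+ 1))
  large n m<n rewrite ℕ.+-comm m 1 = ≡.subst
    (λ N → D (ℤ.- (+ m)) N ≈ (- 1#) ^ (suc m C 2) * t ^ (n ∸ suc m) * D (+ suc m) (n ∸ suc m))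
    (ℕ.m+[n∸m]≡n m<n) (D-reflect m (n ∸ suc m))
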